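{- Let $n\ge 2$ and let $G=(A,B,E)$ be a $(k,\epsilon)$-unbalanced expander with $|A|=n$, $|B|=m$ and left degree $d$, where $1/\epsilon<n$ and $d<n$. Let $\Phi$ be the $m\times n$ adjacency matrix of $G$. Then there is an absolute constant $C>1$ (independent of $n,m,k,d,\epsilon$) such that for every $p$ with $1\le p\le 1+1/\log n$ and every $k$-sparse vector $x\in\mathbb{R}^n$, $$(1-C\epsilon)\,\|x\|_p\;\le\;\|d^{ -1/p}\Phi x\|_p\;\le\;(1+C\epsilon)\,\|x\|_p .$$ (In particular, for $p=1$ one may take $(1-2\epsilon)\|x\|_1\le \|\Phi x\|_1/d\le \|x\|_1$.)
   Context: A $(k,\epsilon)$-unbalanced expander is a simple bipartite graph $G=(A,B,E)$ in which every vertex of $A$ has exactly $d$ neighbours (left degree $d$) such that for every $X\subseteq A$ with $|X|\le k$, the neighbourhood $N(X)\subseteq B$ satisfies $|N(X)|\ge(1-\epsilon)d|X|$. The adjacency matrix of $G$ (with $A=\{1,\dots,n\}$, $B=\{1,\dots,m\}$) is the $m\times n$ $0$–$1$ matrix with entry $(j,i)$ equal to $1$ iff $(i,j)\in E$. A vector is $k$-sparse if it has at most $k$ nonzero coordinates. $\|x\|_p=(\sum_i|x_i|^p)^{1/p}$. -}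

module Defs where

open import Level using (Level; suc)
open import Algebra.Bundles using (CommutativeRing)
open import Axiom.ExcludedMiddle using (ExcludedMiddle)
open import Data.Bool.Base using (if_then_else_)
open import Data.Fin.Base using (Fin; toℕ)
open import Data.Fin.Properties using (any?)
open import Data.Fin.Subset using (Subset; _∈_; ∣_∣)
open import Data.Fin.Subset.Properties using (_∈?_)
open import Data.Nat.Base as ℕ using (ℕ; _!)
open import Data.Product.Base using (∃; _×_; _,_)
open import Data.Sum.Base using ([_,_]′)
open import Data.Vec.Base using (tabulate)
open import Data.Vec.Functional using (Vector)
open import Function.Base using (const)
open import Relation.Binary.Core using (Rel)
open import Relation.Binary.PropositionalEquality.Core using (_≡_)
open import Relation.Binary.Structures using (IsTotalOrder)
open import Relation.Nullary.Decidable.Core using (does; yes; no; ¬?; _×-dec_)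
open import Relation.Nullary.Negation.Core using (¬_)
import Algebra.Properties.Semiring.Exp as Exp
import Algebra.Properties.Semiring.Mult as Mult
import Algebra.Properties.Semiring.Sum as Sum
import Relation.Binary.Construct.NonStrictToStrict as ToStrict

-- The real numbers, presented by their categorical axiomatisation: a totally
-- ordered field in which every inhabited predicate with an upper bound has a
-- least upper bound.  The axioms leave the value of 0# ⁻¹ unspecified.
record CompleteOrderedField (ℓ : Level) : Set (suc ℓ) where
  infix  8 _⁻¹
  infix  4 _≤_
  field
    commutativeRing : CommutativeRing ℓ ℓ

  open CommutativeRing commutativeRing public

  field
    _≤_          : Rel Carrier ℓ
    isTotalOrder : IsTotalOrder _≈_ _≤_
    +-monoʳ-≤    : ∀ x {y z} → y ≤ z → x + y ≤ x + z
    *-nonNeg     : ∀ {x y} → 0# ≤ x → 0# ≤ y → 0# ≤ x * y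
    0≉1          : ¬ (0# ≈ 1#)
    _⁻¹          : Carrier → Carrier
    ⁻¹-cong      : ∀ {x y} → x ≈ y → x ⁻¹ ≈ y ⁻¹
    *-inverseʳ   : ∀ x → ¬ (x ≈ 0#) → x * x ⁻¹ ≈ 1#

  IsUpperBound : (Carrier → Set ℓ) → Carrier → Set ℓ
  IsUpperBound P b = ∀ y → P y → y ≤ b

  IsSupremum : (Carrier → Set ℓ) → Carrier → Set ℓ
  IsSupremum P s = IsUpperBound P s × (∀ b → IsUpperBound P b → s ≤ b)

  field
    complete : ∀ (P : Carrier → Set ℓ) → ∃ P → ∃ (IsUpperBound P) → ∃ (IsSupremum P)

  open ToStrict _≈_ _≤_ public using (_<_)

-- A simple bipartite graph on Fin n and Fin m, given by the neighbourhoods of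
-- its left vertices.
BipartiteGraph : ℕ → ℕ → Set
BipartiteGraph n m = Fin n → Subset m

neighbourhood : ∀ {n m} → BipartiteGraph n m → Subset n → Subset m
neighbourhood G X = tabulate λ j → does (any? λ i → (i ∈? X) ×-dec (j ∈? G i))

module RealAnalysis {ℓ} (em : ExcludedMiddle ℓ) (ℝ : CompleteOrderedField ℓ) where

  open CompleteOrderedField ℝ
  open IsTotalOrder isTotalOrder using (total)
  open Mult semiring using () renaming (_×_ to _·_)
  open Exp semiring using (_^_)
  open Sum semiring using (sum)

  infixr 8 _^ʳ_

  fromℕ : ℕ → Carrier
  fromℕ n = n · 1#

  ∣_∣ʳ : Carrier → Carrier
  ∣ x ∣ʳ = [ const x , const (- x) ]′ (total 0# x)

  -- Totalised: 0# when P has no supremum.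
  sup : (Carrier → Set ℓ) → Carrier
  sup P with em {∃ (IsSupremum P)}
  ... | yes (s , _) = s
  ... | no  _       = 0#

  expSum : Carrier → ℕ → Carrier
  expSum x N = sum {N} λ i → x ^ toℕ i * fromℕ (toℕ i !) ⁻¹

  -- For 0# ≤ x the partial sums of Σ xⁱ / i! increase, so their limit is
  -- their supremum.
  exp⁺ : Carrier → Carrier
  exp⁺ x = sup λ s → ∃ λ N → s ≈ expSum x N

  exp : Carrier → Carrier
  exp x = [ const (exp⁺ x) , const (exp⁺ (- x) ⁻¹) ]′ (total 0# x)

  -- The natural logarithm, for 0# < x.
  ln : Carrier → Carrier
  ln x = sup λ t → exp t ≤ x

  -- Real powers of a base x with 0# ≤ x.  The convention at x ≈ 0# is the
  -- correct one for positive exponents only.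
  _^ʳ_ : Carrier → Carrier → Carrier
  x ^ʳ p with em {x ≈ 0#}
  ... | yes _ = 0#
  ... | no  _ = exp (p * ln x)

  ‖_‖[_] : ∀ {n} → Vector Carrier n → Carrier → Carrier
  ‖ x ‖[ p ] = sum (λ i → ∣ x i ∣ʳ ^ʳ p) ^ʳ (p ⁻¹)

  infixr 7 _∙_
  _∙_ : ∀ {n} → Carrier → Vector Carrier n → Vector Carrier n
  (a ∙ x) i = a * x i

  Matrix : ℕ → ℕ → Set ℓ
  Matrix m n = Fin m → Fin n → Carrier

  infixr 7 _*ᵥ_
  _*ᵥ_ : ∀ {m n} → Matrix m n → Vector Carrier n → Vector Carrier m
  (M *ᵥ x) j = sum λ i → M j i * x i

  support : ∀ {n} → Vector Carrier n → Subset n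
  support x = tabulate λ i → does (¬? (em {x i ≈ 0#}))

  IsSparse : ∀ {n} → ℕ → Vector Carrier n → Set
  IsSparse k x = ∣ support x ∣ ℕ.≤ k

  record IsUnbalancedExpander {n m} (k : ℕ) (ε : Carrier) (d : ℕ)
                              (G : BipartiteGraph n m) : Set ℓ where
    field
      leftRegular : ∀ i → ∣ G i ∣ ≡ d
      expanding   : ∀ (X : Subset n) → ∣ X ∣ ℕ.≤ k →
                    (1# - ε) * fromℕ d * fromℕ ∣ X ∣ ≤ fromℕ ∣ neighbourhood G X ∣

  adjacency : ∀ {n m} → BipartiteGraph n m → Matrix m n
  adjacency G j i = if does (j ∈? G i) then 1# else 0#

{-# OPTIONS --safe #-}
module Submission where

-- Write z i = Φ j i * x i for the terms of the j-th coordinate of Φ x, let a be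
-- the largest |z i|, s = |Σ z i|, r = Σ |z i| - a and q = p - 1.  Since
-- |s - a| ≤ r and s ≤ n a, convexity of t ↦ tᵖ gives |sᵖ - aᵖ| ≤ p nᵠ aᵠ r, where
-- nᵠ ≤ e because q log n ≤ 1.  Comparing y with a / n², each term satisfies
-- aᵠ y ≤ aᵖ / n² + e² yᵖ; summed over the terms other than the largest, and with
-- 1 / n ≤ ε, this bounds the error by K (ε aᵖ + Σ |z i|ᵖ - aᵖ).  Finally
-- Σⱼ Σᵢ |z i|ᵖ = d ‖x‖ᵖ, while expansion, applied to the level sets of |x|ᵖ, gives
-- Σⱼ aᵖ ≥ (1 - ε) d ‖x‖ᵖ, so that the total error is at most 2 K ε d ‖x‖ᵖ.

open import Defs
open import Algebra.Bundles using (CommutativeRing)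
open import Algebra.Solver.Ring.AlmostCommutativeRing
  using (fromCommutativeRing; _-Raw-AlmostCommutative⟶_; Induced-equivalence)
open import Axiom.ExcludedMiddle using (ExcludedMiddle)
open import Data.Bool.Base using (if_then_else_)
open import Data.Fin.Base using (Fin; zero; suc; toℕ)
import Data.Fin.Properties as Fin
open import Data.Fin.Subset using (Subset; _∈_; _∉_; ∣_∣; Nonempty; inside; outside)
  renaming (_-_ to _∖_)
open import Data.Fin.Subset.Properties
  using (_∈?_; nonempty?; x∈p∧x≢y⇒x∈p-y; x∈p⇒∣p-x∣<∣p∣)
open import Data.Integer.Base as ℤ using (ℤ; +_; -[1+_])
import Data.Integer.Properties as ℤ
open import Data.Maybe.Base using (nothing; just)
open import Data.Nat.Base as ℕ using (ℕ; zero; suc; z≤n; s≤s; _!)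
import Data.Nat.Properties as ℕ
open import Data.Product.Base using (∃; _×_; _,_; proj₁; proj₂)
open import Data.Sign.Base as Sign using (Sign)
open import Data.Sum.Base using (inj₁; inj₂)
open import Data.Vec.Base using (_∷_; []; here; there)
open import Data.Vec.Functional using (Vector)
open import Data.Vec.Properties using (lookup∘tabulate; []=⇒lookup; lookup⇒[]=)
open import Function.Base using (_∘_)
open import Relation.Binary.Bundles using (Poset)
open import Relation.Binary.Definitions using (WeaklyDecidable)
open import Relation.Binary.PropositionalEquality.Core as ≡ using (_≡_)
open import Relation.Binary.Structures using (IsTotalOrder)
open import Relation.Nullary.Decidable using (dec-true; dec-false)
open import Relation.Nullary.Decidable.Core using (Dec; does; yes; no; ¬?; _×-dec_)
open import Relation.Nullary.Negation.Core using (¬_; contradiction)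
import Algebra.Properties.AbelianGroup as AbelianGroupProperties
import Algebra.Properties.Ring as RingProperties
import Algebra.Properties.Semiring.Exp as Exp
import Algebra.Properties.Semiring.Mult as Mult
import Algebra.Properties.Semiring.Mult.TCOptimised as Mult′
import Algebra.Properties.Semiring.Sum as Sum
import Algebra.Solver.Ring as RingSolver
import Relation.Binary.Construct.NonStrictToStrict as ToStrict
import Relation.Binary.Reasoning.PartialOrder as PosetReasoning
import Relation.Binary.Reasoning.Setoid as SetoidReasoning

-- For p = 1 the bound |s - a| ≤ r is already linear in the terms. For p > 1 it yields aᵠ r, where
-- one large term multiplies the small ones, while expansion controls only p-th powers: summed over
-- j, the differences Σ |z i|ᵖ - aᵖ are at most ε d ‖x‖ᵖ. So in aᵠ y the factor aᵠ has to be traded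
-- for yᵠ, which costs a bounded factor as long as a / y is at most a fixed power of n. Smaller
-- terms are charged to aᵖ instead. The square in n² makes this affordable: at most n such charges
-- of aᵖ / n² add up to aᵖ / n, and here 1 / ε < n enters. A second obstacle is that `exp` and `ln`
-- are given as suprema. Derivatives are avoided: all convexity is drawn from exp (x + y) = exp x
-- exp y and 1 + x ≤ exp x, and the addition law itself from comparing finite sums over triangles,
-- squares and rectangles of index pairs.

-- Ring normalisation with integer coefficients

module IntegerCoefficients {a b} (R : CommutativeRing a b) where

  open CommutativeRing R
  open RingProperties ring using (-‿distribˡ-*; -‿distribʳ-*)
  open AbelianGroupProperties +-abelianGroup
    using () renaming (⁻¹-∙-comm to -‿+-comm; ε⁻¹≈ε to -0#≈0#; ⁻¹-involutive to -‿involutive)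
  open Mult′ semiring using (1+×; ×-homo-+; ×1-homo-*) renaming (_×_ to _·_)
  open SetoidReasoning setoid

  -- The solver must compute with coefficients to see terms cancel, which works in `ℤ` but not in an
  -- abstract field. With the optimised multiple `⟦ + 1 ⟧ᶻ` reduces to `1#`, so that `:1` in a
  -- solver call stands for `1#` itself.
  ⟦_⟧ᶻ : ℤ → Carrier
  ⟦ + n ⟧ᶻ      = n · 1#
  ⟦ -[1+ n ] ⟧ᶻ = - (suc n · 1#)

  private
    cancel-1# : ∀ x y → (1# + x) - (1# + y) ≈ x - y
    cancel-1# x y = begin
      (1# + x) - (1# + y)      ≈⟨ +-cong (+-comm 1# x) (sym (-‿+-comm 1# y)) ⟩
      (x + 1#) + (- 1# - y)    ≈⟨ +-assoc x 1# _ ⟩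
      x + (1# + (- 1# - y))    ≈⟨ +-congˡ (+-assoc 1# (- 1#) _) ⟨
      x + ((1# - 1#) - y)      ≈⟨ +-congˡ (+-congʳ (-‿inverseʳ 1#)) ⟩
      x + (0# - y)             ≈⟨ +-congˡ (+-identityˡ (- y)) ⟩
      x - y                    ∎

    ⊖-homo : ∀ m n → ⟦ m ℤ.⊖ n ⟧ᶻ ≈ m · 1# - n · 1#
    ⊖-homo zero    zero    = sym (-‿inverseʳ 0#)
    ⊖-homo zero    (suc n) = sym (+-identityˡ _)
    ⊖-homo (suc m) zero    = sym (trans (+-congˡ -0#≈0#) (+-identityʳ _))
    ⊖-homo (suc m) (suc n) = begin
      ⟦ suc m ℤ.⊖ suc n ⟧ᶻ             ≡⟨ ≡.cong ⟦_⟧ᶻ (ℤ.[1+m]⊖[1+n]≡m⊖n m n) ⟩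
      ⟦ m ℤ.⊖ n ⟧ᶻ                     ≈⟨ ⊖-homo m n ⟩
      m · 1# - n · 1#                  ≈⟨ cancel-1# (m · 1#) (n · 1#) ⟨
      (1# + m · 1#) - (1# + n · 1#)    ≈⟨ +-cong (1+× m 1#) (-‿cong (1+× n 1#)) ⟨
      suc m · 1# - suc n · 1#          ∎

    +◃-homo : ∀ n → ⟦ Sign.+ ℤ.◃ n ⟧ᶻ ≈ n · 1#
    +◃-homo zero    = refl
    +◃-homo (suc n) = refl

    -◃-homo : ∀ n → ⟦ Sign.- ℤ.◃ n ⟧ᶻ ≈ - (n · 1#)
    -◃-homo zero    = sym -0#≈0#
    -◃-homo (suc n) = refl

    +-homo : ∀ i j → ⟦ i ℤ.+ j ⟧ᶻ ≈ ⟦ i ⟧ᶻ + ⟦ j ⟧ᶻ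
    +-homo (+ m)      (+ n)      = ×-homo-+ 1# m n
    +-homo (+ m)      (-[1+ n ]) = ⊖-homo m (suc n)
    +-homo (-[1+ m ]) (+ n)      = trans (⊖-homo n (suc m)) (+-comm _ _)
    +-homo (-[1+ m ]) (-[1+ n ]) = begin
      - (suc (suc (m ℕ.+ n)) · 1#)      ≡⟨ ≡.cong (λ k → - (k · 1#)) (ℕ.+-suc (suc m) n) ⟨
      - ((suc m ℕ.+ suc n) · 1#)        ≈⟨ -‿cong (×-homo-+ 1# (suc m) (suc n)) ⟩
      - (suc m · 1# + suc n · 1#)       ≈⟨ -‿+-comm _ _ ⟨
      - (suc m · 1#) - suc n · 1#       ∎

    *-homo : ∀ i j → ⟦ i ℤ.* j ⟧ᶻ ≈ ⟦ i ⟧ᶻ * ⟦ j ⟧ᶻ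
    *-homo (+ m)      (+ n)      = trans (+◃-homo (m ℕ.* n)) (×1-homo-* m n)
    *-homo (+ m)      (-[1+ n ]) = begin
      ⟦ Sign.- ℤ.◃ m ℕ.* suc n ⟧ᶻ   ≈⟨ -◃-homo (m ℕ.* suc n) ⟩
      - ((m ℕ.* suc n) · 1#)        ≈⟨ -‿cong (×1-homo-* m (suc n)) ⟩
      - (m · 1# * suc n · 1#)       ≈⟨ -‿distribʳ-* _ _ ⟩
      m · 1# * - (suc n · 1#)       ∎
    *-homo (-[1+ m ]) (+ n)      = begin
      ⟦ Sign.- ℤ.◃ suc m ℕ.* n ⟧ᶻ   ≈⟨ -◃-homo (suc m ℕ.* n) ⟩
      - ((suc m ℕ.* n) · 1#)        ≈⟨ -‿cong (×1-homo-* (suc m) n) ⟩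
      - (suc m · 1# * n · 1#)       ≈⟨ -‿distribˡ-* _ _ ⟩
      - (suc m · 1#) * n · 1#       ∎
    *-homo (-[1+ m ]) (-[1+ n ]) = begin
      (suc m ℕ.* suc n) · 1#             ≈⟨ ×1-homo-* (suc m) (suc n) ⟩
      suc m · 1# * suc n · 1#            ≈⟨ -‿involutive _ ⟨
      - - (suc m · 1# * suc n · 1#)      ≈⟨ -‿cong (-‿distribʳ-* _ _) ⟩
      - (suc m · 1# * - (suc n · 1#))    ≈⟨ -‿distribˡ-* _ _ ⟩
      - (suc m · 1#) * - (suc n · 1#)    ∎

    -‿homo : ∀ i → ⟦ ℤ.- i ⟧ᶻ ≈ - ⟦ i ⟧ᶻ
    -‿homo (+ zero)   = sym -0#≈0#
    -‿homo (+ suc n)  = refl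
    -‿homo (-[1+ n ]) = sym (-‿involutive _)

  morphism : ℤ.+-*-rawRing -Raw-AlmostCommutative⟶ fromCommutativeRing R
  morphism = record
    { ⟦_⟧    = ⟦_⟧ᶻ
    ; +-homo = +-homo
    ; *-homo = *-homo
    ; -‿homo = -‿homo
    ; 0-homo = refl
    ; 1-homo = refl
    }

  private
    ≈-weaklyDec : WeaklyDecidable (Induced-equivalence morphism)
    ≈-weaklyDec i j with i ℤ.≟ j
    ... | yes i≡j = just (reflexive (≡.cong ⟦_⟧ᶻ i≡j))
    ... | no  _   = nothing

  open RingSolver ℤ.+-*-rawRing (fromCommutativeRing R) morphism ≈-weaklyDec public
    using (Polynomial; solve; _:=_; _:+_; _:*_; _:-_; :-_; con)

  :0 :1 : ∀ {n} → Polynomial n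
  :0 = con (+ 0)
  :1 = con (+ 1)

-- Arithmetic of ordered fields and finite sums

module OrderedField {ℓ} (em : ExcludedMiddle ℓ) (ℝ : CompleteOrderedField ℓ) where

  open CompleteOrderedField ℝ hiding (zero)
  open RealAnalysis em ℝ using (fromℕ)
  open IntegerCoefficients commutativeRing
  open Sum semiring using (sum)
  open IsTotalOrder isTotalOrder public using (total; antisym; isPartialOrder)
    renaming (refl to ≤-refl; trans to ≤-trans; reflexive to ≤-reflexive;
              ≤-respʳ-≈ to ≤-respʳ; ≤-respˡ-≈ to ≤-respˡ)

  poset : Poset ℓ ℓ ℓ
  poset = record { isPartialOrder = isPartialOrder }

  open PosetReasoning poset

  <-≤-trans : ∀ {x y z} → x < y → y ≤ z → x < z
  <-≤-trans = ToStrict.<-≤-trans _≈_ _≤_ sym ≤-trans antisym ≤-respʳ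

  ≤-<-trans : ∀ {x y z} → x ≤ y → y < z → x < z
  ≤-<-trans = ToStrict.≤-<-trans _≈_ _≤_ ≤-trans antisym ≤-respˡ

  <⇒≱ : ∀ {x y} → x < y → ¬ (y ≤ x)
  <⇒≱ = ToStrict.<⇒≱ _≈_ _≤_ antisym

  ≰⇒> : ∀ {x y} → ¬ (x ≤ y) → y < x
  ≰⇒> = ToStrict.≰⇒> _≈_ _≤_ sym ≤-reflexive total

  -- Inequalities are proved by exhibiting the difference of the two sides as
  -- a nonnegative expression z, the identity being left to the ring solver.
  ≤-by : ∀ {x y z} → 0# ≤ z → y ≈ x + z → x ≤ y
  ≤-by {x} {y} {z} 0≤z y≈x+z = begin
    x       ≈⟨ +-identityʳ x ⟨
    x + 0#  ≤⟨ +-monoʳ-≤ x 0≤z ⟩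
    x + z   ≈⟨ y≈x+z ⟨
    y       ∎

  x≤y⇒0≤y-x : ∀ {x y} → x ≤ y → 0# ≤ y - x
  x≤y⇒0≤y-x {x} {y} x≤y = begin
    0#     ≈⟨ solve 1 (λ x → :0 := :- x :+ x) refl x ⟩
    - x + x  ≤⟨ +-monoʳ-≤ (- x) x≤y ⟩
    - x + y  ≈⟨ +-comm _ _ ⟩
    y - x  ∎

  0≤y-x⇒x≤y : ∀ {x y} → 0# ≤ y - x → x ≤ y
  0≤y-x⇒x≤y {x} {y} 0≤y-x =
    ≤-by 0≤y-x (solve 2 (λ x y → y := x :+ (y :- x)) refl x y)

  +-mono-≤ : ∀ {x y u v} → x ≤ y → u ≤ v → x + u ≤ y + v
  +-mono-≤ {x} {y} {u} {v} x≤y u≤v = begin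
    x + u  ≈⟨ +-comm x u ⟩
    u + x  ≤⟨ +-monoʳ-≤ u x≤y ⟩
    u + y  ≈⟨ +-comm u y ⟩
    y + u  ≤⟨ +-monoʳ-≤ y u≤v ⟩
    y + v  ∎

  +-nonNeg : ∀ {x y} → 0# ≤ x → 0# ≤ y → 0# ≤ x + y
  +-nonNeg 0≤x 0≤y = ≤-respˡ (+-identityˡ 0#) (+-mono-≤ 0≤x 0≤y)

  -‿mono-≤ : ∀ {x y} → x ≤ y → - y ≤ - x
  -‿mono-≤ {x} {y} x≤y = ≤-by (x≤y⇒0≤y-x x≤y)
    (solve 2 (λ x y → :- x := :- y :+ (y :- x)) refl x y)

  x≤0⇒0≤-x : ∀ {x} → x ≤ 0# → 0# ≤ - x
  x≤0⇒0≤-x x≤0 = ≤-respʳ (+-identityˡ _) (x≤y⇒0≤y-x x≤0)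

  0≤-x⇒x≤0 : ∀ {x} → 0# ≤ - x → x ≤ 0#
  0≤-x⇒x≤0 0≤-x = 0≤y-x⇒x≤y (≤-respʳ (sym (+-identityˡ _)) 0≤-x)

  *-monoˡ-≤ : ∀ {z x y} → 0# ≤ z → x ≤ y → z * x ≤ z * y
  *-monoˡ-≤ {z} {x} {y} 0≤z x≤y = ≤-by (*-nonNeg 0≤z (x≤y⇒0≤y-x x≤y))
    (solve 3 (λ x y z → z :* y := z :* x :+ z :* (y :- x)) refl x y z)

  *-monoʳ-≤ : ∀ {z x y} → 0# ≤ z → x ≤ y → x * z ≤ y * z
  *-monoʳ-≤ {z} {x} {y} 0≤z x≤y = ≤-by (*-nonNeg 0≤z (x≤y⇒0≤y-x x≤y))
    (solve 3 (λ x y z → y :* z := x :* z :+ z :* (y :- x)) refl x y z)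

  *-mono-≤ : ∀ {x y u v} → 0# ≤ y → 0# ≤ u → x ≤ y → u ≤ v → x * u ≤ y * v
  *-mono-≤ 0≤y 0≤u x≤y u≤v = ≤-trans (*-monoʳ-≤ 0≤u x≤y) (*-monoˡ-≤ 0≤y u≤v)

  0≤1 : 0# ≤ 1#
  0≤1 with total 0# 1#
  ... | inj₁ p = p
  ... | inj₂ p = ≤-respʳ (solve 0 (:- :1 :* :- :1 := :1) refl)
                   (*-nonNeg (x≤0⇒0≤-x p) (x≤0⇒0≤-x p))

  0<1 : 0# < 1#
  0<1 = 0≤1 , 0≉1

  0≤2 : 0# ≤ 1# + 1#
  0≤2 = +-nonNeg 0≤1 0≤1

  x≤x+y : ∀ {x y} → 0# ≤ y → x ≤ x + y
  x≤x+y 0≤y = ≤-by 0≤y refl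

  y≤x+y : ∀ {x y} → 0# ≤ x → y ≤ x + y
  y≤x+y 0≤x = ≤-by 0≤x (+-comm _ _)

  *-inverseˡ : ∀ x → ¬ (x ≈ 0#) → x ⁻¹ * x ≈ 1#
  *-inverseˡ x x≉0 = trans (*-comm _ _) (*-inverseʳ x x≉0)

  <⇒≉0 : ∀ {x} → 0# < x → ¬ (x ≈ 0#)
  <⇒≉0 (_ , 0≉x) x≈0 = 0≉x (sym x≈0)

  *-cancelˡ : ∀ {a x y} → ¬ (a ≈ 0#) → a * x ≈ a * y → x ≈ y
  *-cancelˡ {a} {x} {y} a≉0 ax≈ay = begin-equality
    x                ≈⟨ *-identityˡ x ⟨
    1# * x           ≈⟨ *-congʳ (*-inverseˡ a a≉0) ⟨
    (a ⁻¹ * a) * x   ≈⟨ *-assoc _ _ _ ⟩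
    a ⁻¹ * (a * x)   ≈⟨ *-congˡ ax≈ay ⟩
    a ⁻¹ * (a * y)   ≈⟨ *-assoc _ _ _ ⟨
    (a ⁻¹ * a) * y   ≈⟨ *-congʳ (*-inverseˡ a a≉0) ⟩
    1# * y           ≈⟨ *-identityˡ y ⟩
    y                ∎

  *-cancelˡ-≤ : ∀ {a x y} → 0# < a → a * x ≤ a * y → x ≤ y
  *-cancelˡ-≤ {a} {x} {y} 0<a ax≤ay with total x y
  ... | inj₁ x≤y = x≤y
  ... | inj₂ y≤x = ≤-reflexive
    (*-cancelˡ (<⇒≉0 0<a) (antisym ax≤ay (*-monoˡ-≤ (proj₁ 0<a) y≤x)))

  ⁻¹-unique : ∀ {x y} → x * y ≈ 1# → y ≈ x ⁻¹
  ⁻¹-unique {x} {y} xy≈1 = *-cancelˡ x≉0 (trans xy≈1 (sym (*-inverseʳ x x≉0)))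
    where
    x≉0 : ¬ (x ≈ 0#)
    x≉0 x≈0 = 0≉1 (trans (sym (zeroˡ y)) (trans (*-congʳ (sym x≈0)) xy≈1))

  *-pos : ∀ {x y} → 0# < x → 0# < y → 0# < x * y
  *-pos {x} {y} 0<x 0<y = *-nonNeg (proj₁ 0<x) (proj₁ 0<y) , λ 0≈xy →
    proj₂ 0<y (sym (*-cancelˡ (<⇒≉0 0<x) (trans (sym 0≈xy) (sym (zeroʳ x)))))

  ⁻¹-pos : ∀ {x} → 0# < x → 0# < x ⁻¹
  ⁻¹-pos {x} 0<x = ≰⇒> λ x⁻¹≤0 → <⇒≱ 0<1 (0≤-x⇒x≤0
    (≤-respʳ (trans (solve 2 (λ x y → x :* :- y := :- (x :* y)) refl x (x ⁻¹))
                    (-‿cong (*-inverseʳ x (<⇒≉0 0<x))))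
             (*-nonNeg (proj₁ 0<x) (x≤0⇒0≤-x x⁻¹≤0))))

  1⁻¹≈1 : 1# ⁻¹ ≈ 1#
  1⁻¹≈1 = sym (⁻¹-unique (*-identityˡ 1#))

  fromℕ-nonNeg : ∀ n → 0# ≤ fromℕ n
  fromℕ-nonNeg zero    = ≤-refl
  fromℕ-nonNeg (suc n) = +-nonNeg 0≤1 (fromℕ-nonNeg n)

  fromℕ-mono : ∀ {m n} → m ℕ.≤ n → fromℕ m ≤ fromℕ n
  fromℕ-mono {n = n} z≤n = fromℕ-nonNeg n
  fromℕ-mono (s≤s m≤n) = +-monoʳ-≤ 1# (fromℕ-mono m≤n)

  fromℕ-1≤ : ∀ n → 1# ≤ fromℕ (suc n)
  fromℕ-1≤ n = x≤x+y {1#} {fromℕ n} (fromℕ-nonNeg n)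

  fromℕ-pos : ∀ n → 0# < fromℕ (suc n)
  fromℕ-pos n = <-≤-trans 0<1 (fromℕ-1≤ n)

  fromℕ-2 : fromℕ 2 ≈ 1# + 1#
  fromℕ-2 = solve 0 (:1 :+ (:1 :+ :0) := :1 :+ :1) refl

  sum-mono : ∀ {n} {f g : Fin n → Carrier} → (∀ i → f i ≤ g i) → sum f ≤ sum g
  sum-mono {zero}  f≤g = ≤-refl
  sum-mono {suc n} f≤g = +-mono-≤ (f≤g zero) (sum-mono (f≤g ∘ suc))

  sum-nonNeg : ∀ {n} {f : Fin n → Carrier} → (∀ i → 0# ≤ f i) → 0# ≤ sum f
  sum-nonNeg {zero}  0≤f = ≤-refl
  sum-nonNeg {suc n} 0≤f = +-nonNeg (0≤f zero) (sum-nonNeg (0≤f ∘ suc))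

  term≤sum : ∀ {n} {f : Fin n → Carrier} → (∀ i → 0# ≤ f i) → ∀ i → f i ≤ sum f
  term≤sum 0≤f zero    = x≤x+y (sum-nonNeg (0≤f ∘ suc))
  term≤sum 0≤f (suc i) = ≤-trans (term≤sum (0≤f ∘ suc) i) (y≤x+y (0≤f zero))

  sum-const : ∀ n x → sum {n} (λ _ → x) ≈ fromℕ n * x
  sum-const zero    x = sym (zeroˡ x)
  sum-const (suc n) x = trans (+-congˡ (sum-const n x))
    (solve 2 (λ x y → x :+ y :* x := (:1 :+ y) :* x) refl x (fromℕ n))

  argmax : ∀ {n} (f : Fin (suc n) → Carrier) → ∃ λ m → ∀ i → f i ≤ f m
  argmax {zero}  f = zero , λ { zero → ≤-refl }
  argmax {suc n} f with argmax (f ∘ suc)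
  ... | m , max with total (f zero) (f (suc m))
  ...   | inj₁ p = suc m , λ { zero → p ; (suc i) → max i }
  ...   | inj₂ p = zero , λ { zero → ≤-refl ; (suc i) → ≤-trans (max i) p }

-- Cauchy products of series

module Series {ℓ} (em : ExcludedMiddle ℓ) (ℝ : CompleteOrderedField ℓ) where

  open CompleteOrderedField ℝ hiding (zero)
  open RealAnalysis em ℝ using (fromℕ)
  open OrderedField em ℝ
  open IntegerCoefficients commutativeRing
  open Sum semiring using (sum)
  open PosetReasoning poset

  partial : (ℕ → Carrier) → ℕ → Carrier
  partial a N = sum {N} (a ∘ toℕ)

  partial-suc : ∀ a N → partial a (suc N) ≈ partial a N + a N
  partial-suc a zero    = +-comm _ _
  partial-suc a (suc N) =
    trans (+-congˡ (partial-suc (a ∘ suc) N)) (sym (+-assoc _ _ _))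

  partial-nonNeg : ∀ {a} → (∀ i → 0# ≤ a i) → ∀ N → 0# ≤ partial a N
  partial-nonNeg 0≤a N = sum-nonNeg {N} (0≤a ∘ toℕ)

  partial-mono : ∀ {a} → (∀ i → 0# ≤ a i) → ∀ {M N} → M ℕ.≤ N → partial a M ≤ partial a N
  partial-mono 0≤a {N = N} z≤n = partial-nonNeg 0≤a N
  partial-mono 0≤a (s≤s M≤N)   = +-monoʳ-≤ _ (partial-mono (0≤a ∘ suc) M≤N)

  -- The coefficient of order `k` in the Cauchy product, peeled from the front of `a` because
  -- `partial` and `triangle` recurse in the same way.
  conv : (a b : ℕ → Carrier) → ℕ → Carrier
  conv a b zero    = a 0 * b 0
  conv a b (suc k) = a 0 * b (suc k) + conv (a ∘ suc) b k

  -- The sum of a i * b j over all i + j < N.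
  triangle : (a b : ℕ → Carrier) → ℕ → Carrier
  triangle a b zero    = 0#
  triangle a b (suc N) = a 0 * partial b (suc N) + triangle (a ∘ suc) b N

  triangle-suc : ∀ a b N → triangle a b (suc N) ≈ triangle a b N + conv a b N
  triangle-suc a b zero    =
    solve 2 (λ a b → a :* (b :+ :0) :+ :0 := :0 :+ a :* b) refl (a 0) (b 0)
  triangle-suc a b (suc N) = begin-equality
    a 0 * partial b (suc (suc N)) + triangle (a ∘ suc) b (suc N)
      ≈⟨ +-cong (*-congˡ (partial-suc b (suc N))) (triangle-suc (a ∘ suc) b N) ⟩
    a 0 * (partial b (suc N) + b (suc N)) + (triangle (a ∘ suc) b N + conv (a ∘ suc) b N)
      ≈⟨ solve 5 (λ a p b t c → a :* (p :+ b) :+ (t :+ c) := a :* p :+ t :+ (a :* b :+ c))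
           refl (a 0) (partial b (suc N)) (b (suc N)) _ _ ⟩
    triangle a b (suc N) + conv a b (suc N) ∎

  triangle≈partial-conv : ∀ a b N → triangle a b N ≈ partial (conv a b) N
  triangle≈partial-conv a b zero    = refl
  triangle≈partial-conv a b (suc N) = begin-equality
    triangle a b (suc N)                ≈⟨ triangle-suc a b N ⟩
    triangle a b N + conv a b N         ≈⟨ +-congʳ (triangle≈partial-conv a b N) ⟩
    partial (conv a b) N + conv a b N   ≈⟨ partial-suc (conv a b) N ⟨
    partial (conv a b) (suc N)          ∎

  module _ {b : ℕ → Carrier} (0≤b : ∀ i → 0# ≤ b i) where

    triangle-nonNeg : ∀ {a} → (∀ i → 0# ≤ a i) → ∀ N → 0# ≤ triangle a b N
    triangle-nonNeg 0≤a zero    = ≤-refl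
    triangle-nonNeg 0≤a (suc N) =
      +-nonNeg (*-nonNeg (0≤a 0) (partial-nonNeg 0≤b (suc N))) (triangle-nonNeg (0≤a ∘ suc) N)

    triangle≤square : ∀ {a} → (∀ i → 0# ≤ a i) → ∀ N →
                      triangle a b N ≤ partial a N * partial b N
    triangle≤square 0≤a zero = ≤-reflexive (sym (zeroˡ _))
    triangle≤square {a} 0≤a (suc N) = begin
      a 0 * partial b (suc N) + triangle (a ∘ suc) b N
        ≤⟨ +-monoʳ-≤ _ (triangle≤square (0≤a ∘ suc) N) ⟩
      a 0 * partial b (suc N) + partial (a ∘ suc) N * partial b N
        ≤⟨ +-monoʳ-≤ _ (*-monoˡ-≤ (partial-nonNeg (0≤a ∘ suc) N) (partial-mono 0≤b (ℕ.n≤1+n N))) ⟩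
      a 0 * partial b (suc N) + partial (a ∘ suc) N * partial b (suc N)
        ≈⟨ distribʳ _ _ _ ⟨
      partial a (suc N) * partial b (suc N) ∎

    -- Indices i < N and j < M satisfy i + j < N + M. Together with `triangle≤square` this traps the
    -- product of two suprema between partial sums of the Cauchy product, so no infinite series is
    -- ever rearranged.
    rectangle≤triangle : ∀ {a} → (∀ i → 0# ≤ a i) → ∀ N M →
                         partial a N * partial b M ≤ triangle a b (N ℕ.+ M)
    rectangle≤triangle 0≤a zero    M = ≤-respˡ (sym (zeroˡ _)) (triangle-nonNeg 0≤a M)
    rectangle≤triangle {a} 0≤a (suc N) M = begin
      partial a (suc N) * partial b M
        ≈⟨ distribʳ _ _ _ ⟩
      a 0 * partial b M + partial (a ∘ suc) N * partial b M
        ≤⟨ +-mono-≤ (*-monoˡ-≤ (0≤a 0) (partial-mono 0≤b (ℕ.m≤n+m M (suc N))))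
                    (rectangle≤triangle (0≤a ∘ suc) N M) ⟩
      triangle a b (suc N ℕ.+ M) ∎

  -- The hypotheses say that f = Σ aᵢ tˢ⁺ⁱ and g = Σ bᵢ tⁱ satisfy
  -- f′ = x f + s a₀ tˢ⁻¹ and g′ = y g; the conclusion is the product rule
  -- (f g)′ = (x + y) f g + s a₀ tˢ⁻¹ g.  The exponent s lets the induction drop a₀.
  conv-recurrence : ∀ {x y} {b : ℕ → Carrier} →
    (∀ i → fromℕ (suc i) * b (suc i) ≈ y * b i) →
    ∀ s {a} → (∀ i → (s + fromℕ (suc i)) * a (suc i) ≈ x * a i) →
    ∀ k → (s + fromℕ (suc k)) * conv a b (suc k) ≈ (x + y) * conv a b k + s * (a 0 * b (suc k))
  conv-recurrence {x} {y} {b} rec-b s {a} rec-a zero = begin-equality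
    (s + fromℕ 1) * (a 0 * b 1 + a 1 * b 0)
      ≈⟨ solve 6 (λ s i a₀ a₁ b₀ b₁ → (s :+ i) :* (a₀ :* b₁ :+ a₁ :* b₀) :=
                   a₀ :* (i :* b₁) :+ (s :+ i) :* a₁ :* b₀ :+ s :* (a₀ :* b₁))
           refl s (fromℕ 1) (a 0) (a 1) (b 0) (b 1) ⟩
    a 0 * (fromℕ 1 * b 1) + (s + fromℕ 1) * a 1 * b 0 + s * (a 0 * b 1)
      ≈⟨ +-congʳ (+-cong (*-congˡ (rec-b 0)) (*-congʳ (rec-a 0))) ⟩
    a 0 * (y * b 0) + x * a 0 * b 0 + s * (a 0 * b 1)
      ≈⟨ solve 5 (λ x y a b c → a :* (y :* b) :+ x :* a :* b :+ c := (x :+ y) :* (a :* b) :+ c)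
           refl x y (a 0) (b 0) (s * (a 0 * b 1)) ⟩
    (x + y) * (a 0 * b 0) + s * (a 0 * b 1) ∎
  conv-recurrence {x} {y} {b} rec-b s {a} rec-a (suc k) = begin-equality
    (s + fromℕ (2 ℕ.+ k)) * (a 0 * b (2 ℕ.+ k) + conv a′ b (suc k))
      ≈⟨ solve 5 (λ s i a b c → (s :+ (:1 :+ i)) :* (a :* b :+ c) :=
                   a :* ((:1 :+ i) :* b) :+ ((s :+ :1) :+ i) :* c :+ s :* (a :* b))
           refl s (fromℕ (suc k)) (a 0) (b (2 ℕ.+ k)) (conv a′ b (suc k)) ⟩
    a 0 * (fromℕ (2 ℕ.+ k) * b (2 ℕ.+ k)) + ((s + 1#) + fromℕ (suc k)) * conv a′ b (suc k) + e
      ≈⟨ +-congʳ (+-cong (*-congˡ (rec-b (suc k))) (conv-recurrence rec-b (s + 1#) rec-a′ k)) ⟩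
    a 0 * (y * b (suc k)) + ((x + y) * conv a′ b k + (s + 1#) * (a 1 * b (suc k))) + e
      ≈⟨ solve 8 (λ x y s a₀ a₁ b c e →
             a₀ :* (y :* b) :+ ((x :+ y) :* c :+ (s :+ :1) :* (a₁ :* b)) :+ e :=
             a₀ :* (y :* b) :+ ((x :+ y) :* c :+ (s :+ (:1 :+ :0)) :* a₁ :* b) :+ e)
           refl x y s (a 0) (a 1) (b (suc k)) (conv a′ b k) e ⟩
    a 0 * (y * b (suc k)) + ((x + y) * conv a′ b k + (s + fromℕ 1) * a 1 * b (suc k)) + e
      ≈⟨ +-congʳ (+-congˡ (+-congˡ (*-congʳ (rec-a 0)))) ⟩
    a 0 * (y * b (suc k)) + ((x + y) * conv a′ b k + x * a 0 * b (suc k)) + e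
      ≈⟨ solve 6 (λ x y a b c e → a :* (y :* b) :+ ((x :+ y) :* c :+ x :* a :* b) :+ e :=
                   (x :+ y) :* (a :* b :+ c) :+ e)
           refl x y (a 0) (b (suc k)) (conv a′ b k) e ⟩
    (x + y) * (a 0 * b (suc k) + conv a′ b k) + e ∎
    where
    a′ = a ∘ suc
    e = s * (a 0 * b (2 ℕ.+ k))
    rec-a′ : ∀ i → ((s + 1#) + fromℕ (suc i)) * a′ (suc i) ≈ x * a′ i
    rec-a′ i = trans (*-congʳ (+-assoc s 1# _)) (rec-a (suc i))

-- Partial sums of the exponential series

module Exponential {ℓ} (em : ExcludedMiddle ℓ) (ℝ : CompleteOrderedField ℓ) where

  open CompleteOrderedField ℝ hiding (zero)
  open RealAnalysis em ℝ
  open OrderedField em ℝ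
  open Series em ℝ
  open IntegerCoefficients commutativeRing
  open Exp semiring using (_^_; ^-congˡ)
  open Mult semiring using (×1-homo-*)
  open Sum semiring using (sum-cong-≋)
  open PosetReasoning poset

  expTerm : Carrier → ℕ → Carrier
  expTerm x i = x ^ i * fromℕ (i !) ⁻¹

  fromℕ!-pos : ∀ i → 0# < fromℕ (i !)
  fromℕ!-pos i = <-≤-trans 0<1 (≤-trans (fromℕ-1≤ 0) (fromℕ-mono (ℕ.1≤n! i)))

  -- The differential equation of the exponential, read off coefficient by coefficient in the form
  -- that `conv-recurrence` expects.
  expTerm-suc : ∀ x i → fromℕ (suc i) * expTerm x (suc i) ≈ x * expTerm x i
  expTerm-suc x i = begin-equality
    S * (x * x ^ i * G ⁻¹)    ≈⟨ solve 4 (λ s x y g → s :* (x :* y :* g) := x :* (y :* (s :* g)))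
                                   refl S x (x ^ i) (G ⁻¹) ⟩
    x * (x ^ i * (S * G ⁻¹))  ≈⟨ *-congˡ (*-congˡ (⁻¹-unique (begin-equality
      F * (S * G ⁻¹)   ≈⟨ solve 3 (λ f s g → f :* (s :* g) := (s :* f) :* g) refl F S (G ⁻¹) ⟩
      (S * F) * G ⁻¹   ≈⟨ *-congʳ (×1-homo-* (suc i) (i !)) ⟨
      G * G ⁻¹         ≈⟨ *-inverseʳ G (<⇒≉0 (fromℕ!-pos (suc i))) ⟩
      1#               ∎))) ⟩
    x * (x ^ i * F ⁻¹)        ∎
    where
    S = fromℕ (suc i)
    F = fromℕ (i !)
    G = fromℕ (suc i !)

  expTerm-0 : ∀ x → expTerm x 0 ≈ 1#
  expTerm-0 x = trans (*-identityˡ _) (sym (⁻¹-unique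
    (solve 0 ((:1 :+ :0) :* :1 := :1) refl)))

  ^-nonNeg : ∀ {x} → 0# ≤ x → ∀ i → 0# ≤ x ^ i
  ^-nonNeg 0≤x zero    = 0≤1
  ^-nonNeg 0≤x (suc i) = *-nonNeg 0≤x (^-nonNeg 0≤x i)

  expTerm-nonNeg : ∀ {x} → 0# ≤ x → ∀ i → 0# ≤ expTerm x i
  expTerm-nonNeg 0≤x i = *-nonNeg (^-nonNeg 0≤x i) (proj₁ (⁻¹-pos (fromℕ!-pos i)))

  expTerm≤^ : ∀ {x} → 0# ≤ x → ∀ i → expTerm x i ≤ x ^ i
  expTerm≤^ {x} 0≤x i = begin
    x ^ i * F ⁻¹          ≤⟨ *-monoˡ-≤ (^-nonNeg 0≤x i) (begin
      F ⁻¹       ≈⟨ *-identityˡ _ ⟨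
      1# * F ⁻¹  ≤⟨ *-monoʳ-≤ (proj₁ (⁻¹-pos (fromℕ!-pos i)))
                      (≤-trans (fromℕ-1≤ 0) (fromℕ-mono (ℕ.1≤n! i))) ⟩
      F * F ⁻¹   ≈⟨ *-inverseʳ F (<⇒≉0 (fromℕ!-pos i)) ⟩
      1#         ∎) ⟩
    x ^ i * 1#            ≈⟨ *-identityʳ _ ⟩
    x ^ i                 ∎
    where F = fromℕ (i !)

  -- Both sides solve (k + 1) c (k + 1) = (x + y) c k with the same initial value, which gives the
  -- binomial theorem without binomial coefficients. At `s = 0` the last term of `conv-recurrence`
  -- vanishes.
  conv-expTerm : ∀ x y k → conv (expTerm x) (expTerm y) k ≈ expTerm (x + y) k
  conv-expTerm x y zero = trans (*-cong (expTerm-0 x) (expTerm-0 y))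
    (trans (*-identityˡ 1#) (sym (expTerm-0 (x + y))))
  conv-expTerm x y (suc k) = *-cancelˡ (<⇒≉0 (fromℕ-pos k)) (begin-equality
    fromℕ (suc k) * c (suc k)
      ≈⟨ *-congʳ (+-identityˡ _) ⟨
    (0# + fromℕ (suc k)) * c (suc k)
      ≈⟨ conv-recurrence {x} {y} (expTerm-suc y) 0#
           (λ i → trans (*-congʳ (+-identityˡ _)) (expTerm-suc x i)) k ⟩
    (x + y) * c k + 0# * (expTerm x 0 * expTerm y (suc k))
      ≈⟨ solve 2 (λ u v → u :+ :0 :* v := u) refl _ _ ⟩
    (x + y) * c k
      ≈⟨ *-congˡ (conv-expTerm x y k) ⟩
    (x + y) * expTerm (x + y) k
      ≈⟨ expTerm-suc (x + y) k ⟨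
    fromℕ (suc k) * expTerm (x + y) (suc k) ∎)
    where c = conv (expTerm x) (expTerm y)

  expSum-cong : ∀ {x y} → x ≈ y → ∀ N → expSum x N ≈ expSum y N
  expSum-cong x≈y N = sum-cong-≋ {N} λ i → *-congʳ (^-congˡ (toℕ i) x≈y)

  expSum-+ : ∀ x y N → triangle (expTerm x) (expTerm y) N ≈ expSum (x + y) N
  expSum-+ x y N = trans (triangle≈partial-conv (expTerm x) (expTerm y) N)
    (sum-cong-≋ {N} λ i → conv-expTerm x y (toℕ i))

  expSum-nonNeg : ∀ {x} → 0# ≤ x → ∀ N → 0# ≤ expSum x N
  expSum-nonNeg 0≤x = partial-nonNeg (expTerm-nonNeg 0≤x)

  expSum-+-≤ : ∀ {x y} → 0# ≤ x → 0# ≤ y → ∀ N → expSum (x + y) N ≤ expSum x N * expSum y N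
  expSum-+-≤ {x} {y} 0≤x 0≤y N = ≤-respˡ (expSum-+ x y N)
    (triangle≤square (expTerm-nonNeg 0≤y) (expTerm-nonNeg 0≤x) N)

  expSum-+-≥ : ∀ {x y} → 0# ≤ x → 0# ≤ y → ∀ N M →
               expSum x N * expSum y M ≤ expSum (x + y) (N ℕ.+ M)
  expSum-+-≥ {x} {y} 0≤x 0≤y N M = ≤-respʳ (expSum-+ x y (N ℕ.+ M))
    (rectangle≤triangle (expTerm-nonNeg 0≤y) (expTerm-nonNeg 0≤x) N M)

  -- Comparison with the geometric series, as 1 / i! ≤ 1. The summand `x ^ N` is the remainder of
  -- that series; keeping it makes the induction close.
  expSum-geometric : ∀ {x} → 0# ≤ x → x ≤ 1# → ∀ N → (1# - x) * expSum x N + x ^ N ≤ 1#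
  expSum-geometric {x} 0≤x x≤1 zero = ≤-reflexive
    (solve 1 (λ x → (:1 :- x) :* :0 :+ :1 := :1) refl x)
  expSum-geometric {x} 0≤x x≤1 (suc N) = begin
    (1# - x) * expSum x (suc N) + x * x ^ N
      ≈⟨ +-congʳ (*-congˡ (partial-suc (expTerm x) N)) ⟩
    (1# - x) * (expSum x N + expTerm x N) + x * x ^ N
      ≤⟨ ≤-by (*-nonNeg (x≤y⇒0≤y-x x≤1) (x≤y⇒0≤y-x (expTerm≤^ 0≤x N)))
           (solve 4 (λ x E t X → (:1 :- x) :* E :+ X :=
               (:1 :- x) :* (E :+ t) :+ x :* X :+ (:1 :- x) :* (X :- t))
             refl x (expSum x N) (expTerm x N) (x ^ N)) ⟩
    (1# - x) * expSum x N + x ^ N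
      ≤⟨ expSum-geometric 0≤x x≤1 N ⟩
    1# ∎

  [1-x]expSum≤1 : ∀ {x} → 0# ≤ x → x ≤ 1# → ∀ N → (1# - x) * expSum x N ≤ 1#
  [1-x]expSum≤1 0≤x x≤1 N = ≤-trans (x≤x+y (^-nonNeg 0≤x N)) (expSum-geometric 0≤x x≤1 N)

-- The exponential function and the natural logarithm

module ExpLn {ℓ} (em : ExcludedMiddle ℓ) (ℝ : CompleteOrderedField ℓ) where

  open CompleteOrderedField ℝ hiding (zero)
  open RealAnalysis em ℝ
  open OrderedField em ℝ
  open Exponential em ℝ
  open IntegerCoefficients commutativeRing
  open PosetReasoning poset

  ½ : Carrier
  ½ = (1# + 1#) ⁻¹

  0<2 : 0# < 1# + 1#
  0<2 = <-≤-trans 0<1 (x≤x+y 0≤1)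

  0<½ : 0# < ½
  0<½ = ⁻¹-pos 0<2

  ½+½≈1 : ½ + ½ ≈ 1#
  ½+½≈1 = trans (solve 1 (λ h → h :+ h := (:1 :+ :1) :* h) refl ½) (*-inverseʳ _ (<⇒≉0 0<2))

  ½≤1 : ½ ≤ 1#
  ½≤1 = ≤-respʳ ½+½≈1 (x≤x+y (proj₁ 0<½))

  1-½≈½ : 1# - ½ ≈ ½
  1-½≈½ = trans (+-congʳ (sym ½+½≈1)) (solve 1 (λ h → (h :+ h) :- h := h) refl ½)

  expSum-1 : ∀ y → expSum y 1 ≈ 1#
  expSum-1 y = trans (+-identityʳ _) (expTerm-0 y)

  -- The factor `expSum (y - x) 1` equals 1, which makes this an instance of `expSum-+-≥`. The
  -- additional term on the right does no harm when bounds hold for all `N`.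
  expSum-mono-suc : ∀ {x y} → 0# ≤ x → x ≤ y → ∀ N → expSum x N ≤ expSum y (N ℕ.+ 1)
  expSum-mono-suc {x} {y} 0≤x x≤y N = begin
    expSum x N                       ≈⟨ trans (*-congˡ (expSum-1 (y - x))) (*-identityʳ _) ⟨
    expSum x N * expSum (y - x) 1    ≤⟨ expSum-+-≥ 0≤x (x≤y⇒0≤y-x x≤y) N 1 ⟩
    expSum (x + (y - x)) (N ℕ.+ 1)   ≈⟨ expSum-cong (solve 2 (λ x y → x :+ (y :- x) := y) refl x y) (N ℕ.+ 1) ⟩
    expSum y (N ℕ.+ 1)               ∎

  -- The points at which the series is bounded are closed under adding ½, so
  -- they have no upper bound.
  expSum-bounded : ∀ {x} → 0# ≤ x → ∃ λ M → ∀ N → expSum x N ≤ M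
  expSum-bounded {x} 0≤x with em {∃ λ M → ∀ N → expSum x N ≤ M}
  ... | yes bounded  = bounded
  ... | no unbounded = contradiction s≤s-½ (<⇒≱ s-½<s)
    where
    P : Carrier → Set ℓ
    P b = 0# ≤ b × ∃ λ M → ∀ N → expSum b N ≤ M

    P-0 : P 0#
    P-0 = ≤-refl , 1# , λ N → ≤-respˡ
      (solve 1 (λ E → (:1 :- :0) :* E := E) refl (expSum 0# N)) ([1-x]expSum≤1 ≤-refl 0≤1 N)

    x-upper : IsUpperBound P x
    x-upper b (0≤b , M , below) with total b x
    ... | inj₁ b≤x = b≤x
    ... | inj₂ x≤b = contradiction
      (M , λ N → ≤-trans (expSum-mono-suc 0≤x x≤b N) (below (N ℕ.+ 1))) unbounded

    -- The step ½ lies below 1, where the geometric bound 1 / (1 - x) is finite.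
    expSum-½ : ∀ N → expSum ½ N ≤ 1# + 1#
    expSum-½ N = *-cancelˡ-≤ 0<½ (begin
      ½ * expSum ½ N         ≈⟨ *-congʳ 1-½≈½ ⟨
      (1# - ½) * expSum ½ N  ≤⟨ [1-x]expSum≤1 (proj₁ 0<½) ½≤1 N ⟩
      1#                     ≈⟨ *-inverseˡ _ (<⇒≉0 0<2) ⟨
      ½ * (1# + 1#)          ∎)

    P-+½ : ∀ b → P b → P (b + ½)
    P-+½ b (0≤b , M , below) = +-nonNeg 0≤b (proj₁ 0<½) , M * (1# + 1#) , λ N →
      ≤-trans (expSum-+-≤ 0≤b (proj₁ 0<½) N)
        (*-mono-≤ (≤-trans (expSum-nonNeg 0≤b N) (below N)) (expSum-nonNeg (proj₁ 0<½) N)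
                  (below N) (expSum-½ N))

    supremum : ∃ (IsSupremum P)
    supremum = complete P (0# , P-0) (x , x-upper)

    s = proj₁ supremum

    s≤s-½ : s ≤ s - ½
    s≤s-½ = proj₂ (proj₂ supremum) (s - ½) λ b Pb → 0≤y-x⇒x≤y (≤-respʳ
      (solve 3 (λ s h b → s :- (b :+ h) := s :- h :- b) refl s ½ b)
      (x≤y⇒0≤y-x (proj₁ (proj₂ supremum) (b + ½) (P-+½ b Pb))))

    s-½<s : s - ½ < s
    s-½<s = ≰⇒> λ s≤s-½ → <⇒≱ 0<½ (0≤-x⇒x≤0 (≤-respʳ
      (solve 2 (λ s h → s :- h :- s := :- h) refl s ½) (x≤y⇒0≤y-x s≤s-½)))

  sup-isSupremum : ∀ P → ∃ (IsSupremum P) → IsSupremum P (sup P)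
  sup-isSupremum P supremum with em {∃ (IsSupremum P)}
  ... | yes (_ , isSup) = isSup
  ... | no  none        = contradiction supremum none

  module _ {x} (0≤x : 0# ≤ x) where

    private
      P : Carrier → Set ℓ
      P s = ∃ λ N → s ≈ expSum x N

      exp⁺-isSupremum : IsSupremum P (exp⁺ x)
      exp⁺-isSupremum = sup-isSupremum P (complete P (expSum x 0 , 0 , refl)
        (let M , below = expSum-bounded 0≤x in M , λ { s (N , s≈) → ≤-respˡ (sym s≈) (below N) }))

    expSum≤exp⁺ : ∀ N → expSum x N ≤ exp⁺ x
    expSum≤exp⁺ N = proj₁ exp⁺-isSupremum (expSum x N) (N , refl)

    exp⁺≤ : ∀ {b} → (∀ N → expSum x N ≤ b) → exp⁺ x ≤ b
    exp⁺≤ {b} below = proj₂ exp⁺-isSupremum b λ { s (N , s≈) → ≤-respˡ (sym s≈) (below N) }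

    1+x≤exp⁺ : 1# + x ≤ exp⁺ x
    1+x≤exp⁺ = ≤-respˡ (+-cong (expTerm-0 x) (begin-equality
      expTerm x 1 + 0#        ≈⟨ solve 1 (λ t → t :+ :0 := (:1 :+ :0) :* t) refl (expTerm x 1) ⟩
      fromℕ 1 * expTerm x 1   ≈⟨ expTerm-suc x 0 ⟩
      x * expTerm x 0         ≈⟨ *-congˡ (expTerm-0 x) ⟩
      x * 1#                  ≈⟨ *-identityʳ x ⟩
      x                       ∎)) (expSum≤exp⁺ 2)

    exp⁺-pos : 0# < exp⁺ x
    exp⁺-pos = <-≤-trans 0<1 (≤-trans (x≤x+y 0≤x) 1+x≤exp⁺)

    -- Dividing by `c` turns the hypothesis into an upper bound of the partial sums. If `c` is zero,
    -- the hypothesis at a single index already says that `b` is nonnegative.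
    exp⁺-* : ∀ {c b} → 0# ≤ c → (∀ N → c * expSum x N ≤ b) → c * exp⁺ x ≤ b
    exp⁺-* {c} {b} 0≤c below with em {c ≈ 0#}
    ... | yes c≈0 = ≤-respˡ (trans (zeroʳ c) (sym (trans (*-congʳ c≈0) (zeroˡ _)))) (below 0)
    ... | no  c≉0 = begin
      c * exp⁺ x      ≤⟨ *-monoˡ-≤ 0≤c (exp⁺≤ λ N → *-cancelˡ-≤ 0<c (≤-respʳ (sym c*[c⁻¹*b]≈b) (below N))) ⟩
      c * (c ⁻¹ * b)  ≈⟨ c*[c⁻¹*b]≈b ⟩
      b               ∎
      where
      0<c : 0# < c
      0<c = 0≤c , λ 0≈c → c≉0 (sym 0≈c)
      c*[c⁻¹*b]≈b : c * (c ⁻¹ * b) ≈ b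
      c*[c⁻¹*b]≈b = trans (sym (*-assoc _ _ _)) (trans (*-congʳ (*-inverseʳ c c≉0)) (*-identityˡ b))

  exp⁺-cong : ∀ {x y} → 0# ≤ x → x ≈ y → exp⁺ x ≈ exp⁺ y
  exp⁺-cong 0≤x x≈y = antisym
    (exp⁺≤ 0≤x λ N → ≤-respˡ (sym (expSum-cong x≈y N)) (expSum≤exp⁺ 0≤y N))
    (exp⁺≤ 0≤y λ N → ≤-respˡ (expSum-cong x≈y N) (expSum≤exp⁺ 0≤x N))
    where 0≤y = ≤-respʳ x≈y 0≤x

  exp⁺-+ : ∀ {x y} → 0# ≤ x → 0# ≤ y → exp⁺ (x + y) ≈ exp⁺ x * exp⁺ y
  exp⁺-+ {x} {y} 0≤x 0≤y = antisym
    (exp⁺≤ 0≤x+y λ N → ≤-trans (expSum-+-≤ 0≤x 0≤y N)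
      (*-mono-≤ (proj₁ (exp⁺-pos 0≤x)) (expSum-nonNeg 0≤y N) (expSum≤exp⁺ 0≤x N) (expSum≤exp⁺ 0≤y N)))
    -- The product of two suprema is bounded one factor at a time, the other index being held fixed.
    (exp⁺-* 0≤y (proj₁ (exp⁺-pos 0≤x)) λ M → ≤-respˡ (*-comm _ _)
      (exp⁺-* 0≤x (expSum-nonNeg 0≤y M) λ N → ≤-respˡ (*-comm _ _)
        (≤-trans (expSum-+-≥ 0≤x 0≤y N M) (expSum≤exp⁺ 0≤x+y (N ℕ.+ M)))))
    where 0≤x+y = +-nonNeg 0≤x 0≤y

  exp⁺-0 : exp⁺ 0# ≈ 1#
  exp⁺-0 = antisym
    (exp⁺≤ ≤-refl λ N → ≤-respˡ
      (solve 1 (λ E → (:1 :- :0) :* E := E) refl (expSum 0# N)) ([1-x]expSum≤1 ≤-refl 0≤1 N))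
    (≤-respˡ (+-identityʳ 1#) (1+x≤exp⁺ ≤-refl))

  -- This determines `exp x` from `exp⁺` for every way of writing `x` as a difference of nonnegative
  -- numbers. Thus `exp-cong` and `exp-+` need not compare the branches that `exp` takes.
  exp-difference : ∀ {x a b} → 0# ≤ a → 0# ≤ b → x ≈ a - b → exp x * exp⁺ b ≈ exp⁺ a
  exp-difference {x} {a} {b} 0≤a 0≤b x≈a-b with total 0# x
  ... | inj₁ 0≤x = begin-equality
    exp⁺ x * exp⁺ b  ≈⟨ exp⁺-+ 0≤x 0≤b ⟨
    exp⁺ (x + b)     ≈⟨ exp⁺-cong (+-nonNeg 0≤x 0≤b) (trans (+-congʳ x≈a-b)
                          (solve 2 (λ a b → a :- b :+ b := a) refl a b)) ⟩
    exp⁺ a           ∎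
  ... | inj₂ x≤0 = begin-equality
    exp⁺ (- x) ⁻¹ * exp⁺ b
      ≈⟨ *-congˡ (exp⁺-cong 0≤b (trans (solve 2 (λ a b → b := :- (a :- b) :+ a) refl a b)
                                      (+-congʳ (-‿cong (sym x≈a-b))))) ⟩
    exp⁺ (- x) ⁻¹ * exp⁺ (- x + a)
      ≈⟨ *-congˡ (exp⁺-+ 0≤-x 0≤a) ⟩
    exp⁺ (- x) ⁻¹ * (exp⁺ (- x) * exp⁺ a)
      ≈⟨ *-assoc _ _ _ ⟨
    exp⁺ (- x) ⁻¹ * exp⁺ (- x) * exp⁺ a
      ≈⟨ *-congʳ (*-inverseˡ _ (<⇒≉0 (exp⁺-pos 0≤-x))) ⟩
    1# * exp⁺ a
      ≈⟨ *-identityˡ _ ⟩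
    exp⁺ a ∎
    where 0≤-x = x≤0⇒0≤-x x≤0

  as-difference : ∀ x → ∃ λ a → ∃ λ b → 0# ≤ a × 0# ≤ b × x ≈ a - b
  as-difference x with total 0# x
  ... | inj₁ 0≤x = x , 0# , 0≤x , ≤-refl , solve 1 (λ x → x := x :- :0) refl x
  ... | inj₂ x≤0 = 0# , - x , ≤-refl , x≤0⇒0≤-x x≤0 , solve 1 (λ x → x := :0 :- (:- x)) refl x

  -- Equal arguments may fall into different branches of `total`, so both values are compared
  -- through one common difference.
  exp-cong : ∀ {x y} → x ≈ y → exp x ≈ exp y
  exp-cong {x} {y} x≈y =
    let a , b , 0≤a , 0≤b , y≈a-b = as-difference y in
    *-cancelˡ (<⇒≉0 (exp⁺-pos 0≤b)) (begin-equality
      exp⁺ b * exp x  ≈⟨ *-comm _ _ ⟩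
      exp x * exp⁺ b  ≈⟨ exp-difference 0≤a 0≤b (trans x≈y y≈a-b) ⟩
      exp⁺ a          ≈⟨ exp-difference 0≤a 0≤b y≈a-b ⟨
      exp y * exp⁺ b  ≈⟨ *-comm _ _ ⟩
      exp⁺ b * exp y  ∎)

  exp-+ : ∀ x y → exp (x + y) ≈ exp x * exp y
  exp-+ x y =
    let a , b , 0≤a , 0≤b , x≈a-b = as-difference x
        c , d , 0≤c , 0≤d , y≈c-d = as-difference y
    in *-cancelˡ (<⇒≉0 (exp⁺-pos (+-nonNeg 0≤b 0≤d))) (begin-equality
      exp⁺ (b + d) * exp (x + y)
        ≈⟨ *-comm _ _ ⟩
      exp (x + y) * exp⁺ (b + d)
        ≈⟨ exp-difference (+-nonNeg 0≤a 0≤c) (+-nonNeg 0≤b 0≤d) (trans (+-cong x≈a-b y≈c-d)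
             (solve 4 (λ a b c d → (a :- b) :+ (c :- d) := (a :+ c) :- (b :+ d)) refl a b c d)) ⟩
      exp⁺ (a + c)
        ≈⟨ exp⁺-+ 0≤a 0≤c ⟩
      exp⁺ a * exp⁺ c
        ≈⟨ *-cong (exp-difference 0≤a 0≤b x≈a-b) (exp-difference 0≤c 0≤d y≈c-d) ⟨
      exp x * exp⁺ b * (exp y * exp⁺ d)
        ≈⟨ solve 4 (λ x b y d → x :* b :* (y :* d) := b :* d :* (x :* y)) refl _ _ _ _ ⟩
      exp⁺ b * exp⁺ d * (exp x * exp y)
        ≈⟨ *-congʳ (exp⁺-+ 0≤b 0≤d) ⟨
      exp⁺ (b + d) * (exp x * exp y) ∎)

  exp-nonNeg-arg : ∀ {x} → 0# ≤ x → exp x ≈ exp⁺ x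
  exp-nonNeg-arg {x} 0≤x = begin-equality
    exp x             ≈⟨ *-identityʳ _ ⟨
    exp x * 1#        ≈⟨ *-congˡ exp⁺-0 ⟨
    exp x * exp⁺ 0#   ≈⟨ exp-difference 0≤x ≤-refl (solve 1 (λ x → x := x :- :0) refl x) ⟩
    exp⁺ x            ∎

  exp-0 : exp 0# ≈ 1#
  exp-0 = trans (exp-nonNeg-arg ≤-refl) exp⁺-0

  exp-inverse : ∀ x → exp x * exp (- x) ≈ 1#
  exp-inverse x = trans (sym (exp-+ x (- x))) (trans (exp-cong (-‿inverseʳ x)) exp-0)

  exp-pos : ∀ x → 0# < exp x
  exp-pos x with total 0# x
  ... | inj₁ 0≤x = exp⁺-pos 0≤x
  ... | inj₂ x≤0 = ⁻¹-pos (exp⁺-pos (x≤0⇒0≤-x x≤0))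

  [1-x]exp⁺≤1 : ∀ {x} → 0# ≤ x → (1# - x) * exp⁺ x ≤ 1#
  [1-x]exp⁺≤1 {x} 0≤x with total x 1#
  ... | inj₁ x≤1 = exp⁺-* 0≤x (x≤y⇒0≤y-x x≤1) ([1-x]expSum≤1 0≤x x≤1)
  ... | inj₂ 1≤x = ≤-trans (0≤-x⇒x≤0 (≤-respʳ
    (solve 2 (λ x E → (x :- :1) :* E := :- ((:1 :- x) :* E)) refl x (exp⁺ x))
    (*-nonNeg (x≤y⇒0≤y-x 1≤x) (proj₁ (exp⁺-pos 0≤x))))) 0≤1

  -- For negative `x` this is the geometric bound at `- x`, inverted. Together with the addition law
  -- it carries all later estimates on powers and logarithms.
  1+x≤exp : ∀ x → 1# + x ≤ exp x
  1+x≤exp x with total 0# x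
  ... | inj₁ 0≤x = 1+x≤exp⁺ 0≤x
  ... | inj₂ x≤0 = *-cancelˡ-≤ (exp⁺-pos 0≤-x) (begin
    exp⁺ (- x) * (1# + x)      ≈⟨ solve 2 (λ x E → E :* (:1 :+ x) := (:1 :- (:- x)) :* E)
                                    refl x (exp⁺ (- x)) ⟩
    (1# - (- x)) * exp⁺ (- x)  ≤⟨ [1-x]exp⁺≤1 0≤-x ⟩
    1#                         ≈⟨ *-inverseʳ _ (<⇒≉0 (exp⁺-pos 0≤-x)) ⟨
    exp⁺ (- x) * exp⁺ (- x) ⁻¹ ∎)
    where 0≤-x = x≤0⇒0≤-x x≤0

  exp-tangent : ∀ x y → exp x * (1# + (y - x)) ≤ exp y
  exp-tangent x y = begin
    exp x * (1# + (y - x))  ≤⟨ *-monoˡ-≤ (proj₁ (exp-pos x)) (1+x≤exp (y - x)) ⟩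
    exp x * exp (y - x)     ≈⟨ exp-+ x (y - x) ⟨
    exp (x + (y - x))       ≈⟨ exp-cong (solve 2 (λ x y → x :+ (y :- x) := y) refl x y) ⟩
    exp y                   ∎

  exp-mono : ∀ {x y} → x ≤ y → exp x ≤ exp y
  exp-mono {x} {y} x≤y = ≤-trans
    (≤-by (*-nonNeg (proj₁ (exp-pos x)) (x≤y⇒0≤y-x x≤y))
      (solve 3 (λ x y E → E :* (:1 :+ (y :- x)) := E :+ E :* (y :- x)) refl x y (exp x)))
    (exp-tangent x y)

  -- The tangent at `y`, evaluated at `x`, is at most `exp x` and hence at most `exp y`; cancelling
  -- `exp y` leaves x - y ≤ 0.
  exp-cancel-≤ : ∀ {x y} → exp x ≤ exp y → x ≤ y
  exp-cancel-≤ {x} {y} ex≤ey = 0≤y-x⇒x≤y (≤-respʳ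
    (solve 2 (λ x y → :1 :- (:1 :+ (x :- y)) := y :- x) refl x y)
    (x≤y⇒0≤y-x (*-cancelˡ-≤ (exp-pos y)
      (≤-trans (exp-tangent y x) (≤-trans ex≤ey (≤-reflexive (sym (*-identityʳ _))))))))

  exp-injective : ∀ {x y} → exp x ≈ exp y → x ≈ y
  exp-injective ex≈ey =
    antisym (exp-cancel-≤ (≤-reflexive ex≈ey)) (exp-cancel-≤ (≤-reflexive (sym ex≈ey)))

  module _ {x} (0<x : 0# < x) where

    private
      P : Carrier → Set ℓ
      P t = exp t ≤ x

      ln-isSupremum : IsSupremum P (ln x)
      -- The witness works because 1 / x ≤ exp (1 / x), and `x` is an upper bound because t ≤ 1 + t
      -- ≤ exp t ≤ x.
      ln-isSupremum = sup-isSupremum P (complete P (- (x ⁻¹) , member) (x , λ t et≤x →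
        ≤-trans (y≤x+y 0≤1) (≤-trans (1+x≤exp t) et≤x)))
        where
        member : exp (- (x ⁻¹)) ≤ x
        member = *-cancelˡ-≤ (exp-pos (x ⁻¹)) (begin
          exp (x ⁻¹) * exp (- (x ⁻¹))   ≈⟨ exp-inverse (x ⁻¹) ⟩
          1#                            ≈⟨ *-inverseˡ x (<⇒≉0 0<x) ⟨
          x ⁻¹ * x                      ≤⟨ *-monoʳ-≤ (proj₁ 0<x)
                                             (≤-trans (y≤x+y 0≤1) (1+x≤exp (x ⁻¹))) ⟩
          exp (x ⁻¹) * x                ∎)

      L = ln x
      E = exp L

      -- If exp L < x, then L + h with h = 1 - exp L / x still satisfies
      -- exp (L + h) ≤ x, since exp h ≤ 1 / (1 - h).
      ≥x : x ≤ E
      ≥x with total x E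
      ... | inj₁ x≤E = x≤E
      ... | inj₂ E≤x = *-cancelˡ-≤ (⁻¹-pos 0<x) (begin
        x ⁻¹ * x   ≈⟨ *-inverseˡ x (<⇒≉0 0<x) ⟩
        1#         ≤⟨ 0≤y-x⇒x≤y (≤-respʳ (solve 2 (λ L u → L :- (L :+ (:1 :- u)) := u :- :1)
                        refl L (x ⁻¹ * E)) (x≤y⇒0≤y-x (proj₁ ln-isSupremum (L + h) member))) ⟩
        x ⁻¹ * E   ∎)
        where
        h = 1# - x ⁻¹ * E
        member : exp (L + h) ≤ x
        member = *-cancelˡ-≤ (⁻¹-pos 0<x) (begin
          x ⁻¹ * exp (L + h)            ≈⟨ *-congˡ (exp-+ L h) ⟩
          x ⁻¹ * (E * exp h)            ≈⟨ solve 3 (λ i E e → i :* (E :* e) := e :* (:1 :+ :- (:1 :- i :* E)))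
                                             refl (x ⁻¹) E (exp h) ⟩
          exp h * (1# + - h)            ≤⟨ *-monoˡ-≤ (proj₁ (exp-pos h)) (1+x≤exp (- h)) ⟩
          exp h * exp (- h)             ≈⟨ exp-inverse h ⟩
          1#                            ≈⟨ *-inverseˡ x (<⇒≉0 0<x) ⟨
          x ⁻¹ * x                      ∎)

      -- If x < exp L, then L - h with h = 1 - x / exp L is still an upper bound.
      ≤x : E ≤ x
      ≤x with total E x
      ... | inj₁ E≤x = E≤x
      ... | inj₂ x≤E = *-cancelˡ-≤ (⁻¹-pos (exp-pos L)) (begin
        E ⁻¹ * E   ≈⟨ *-inverseˡ E (<⇒≉0 (exp-pos L)) ⟩
        1#         ≤⟨ 0≤y-x⇒x≤y (≤-respʳ (solve 2 (λ L u → (L :- (:1 :- u)) :- L := u :- :1)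
                        refl L (E ⁻¹ * x)) (x≤y⇒0≤y-x (proj₂ ln-isSupremum (L - h) upper))) ⟩
        E ⁻¹ * x   ∎)
        where
        h = 1# - E ⁻¹ * x
        upper : IsUpperBound P (L - h)
        upper t et≤x = exp-cancel-≤ (begin
          exp t              ≤⟨ et≤x ⟩
          x                  ≈⟨ *-identityˡ x ⟨
          1# * x             ≈⟨ *-congʳ (*-inverseʳ E (<⇒≉0 (exp-pos L))) ⟨
          E * E ⁻¹ * x       ≈⟨ solve 3 (λ E i x → E :* i :* x := E :* (:1 :+ :- (:1 :- i :* x))) refl E (E ⁻¹) x ⟩
          E * (1# + - h)     ≤⟨ *-monoˡ-≤ (proj₁ (exp-pos L)) (1+x≤exp (- h)) ⟩
          E * exp (- h)      ≈⟨ exp-+ L (- h) ⟨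
          exp (L - h)        ∎)

    exp-ln : exp (ln x) ≈ x
    exp-ln = antisym ≤x ≥x

  ln-cong : ∀ {x y} → 0# < x → x ≈ y → ln x ≈ ln y
  ln-cong {x} {y} 0<x x≈y = exp-injective
    (trans (exp-ln 0<x) (trans x≈y (sym (exp-ln (<-≤-trans 0<x (≤-reflexive x≈y))))))

  ln-mono : ∀ {x y} → 0# < x → x ≤ y → ln x ≤ ln y
  ln-mono 0<x x≤y = exp-cancel-≤ (≤-respˡ (sym (exp-ln 0<x))
    (≤-respʳ (sym (exp-ln (<-≤-trans 0<x x≤y))) x≤y))

  ln-exp : ∀ x → ln (exp x) ≈ x
  ln-exp x = exp-injective (exp-ln (exp-pos x))

  ln-* : ∀ {x y} → 0# < x → 0# < y → ln (x * y) ≈ ln x + ln y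
  ln-* {x} {y} 0<x 0<y = exp-injective (begin-equality
    exp (ln (x * y))            ≈⟨ exp-ln (*-pos 0<x 0<y) ⟩
    x * y                       ≈⟨ *-cong (exp-ln 0<x) (exp-ln 0<y) ⟨
    exp (ln x) * exp (ln y)     ≈⟨ exp-+ (ln x) (ln y) ⟨
    exp (ln x + ln y)           ∎)

  ln-1 : ln 1# ≈ 0#
  ln-1 = exp-injective (trans (exp-ln 0<1) (sym exp-0))

  -- The bound 1 + t ≤ exp t at t = - ln x reads 1 - ln x ≤ 1 / x; here it is multiplied by `x`.
  x-1≤x*ln : ∀ {x} → 0# < x → x - 1# ≤ x * ln x
  x-1≤x*ln {x} 0<x = begin
    x - 1#                           ≈⟨ +-congˡ (-‿cong (exp-inverse L)) ⟨
    x - exp L * exp (- L)            ≈⟨ +-congˡ (-‿cong (*-congʳ (exp-ln 0<x))) ⟩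
    x - x * exp (- L)                ≤⟨ ≤-by (*-nonNeg (proj₁ 0<x) (x≤y⇒0≤y-x (1+x≤exp (- L))))
      (solve 3 (λ x L e → x :* L := x :- x :* e :+ x :* (e :- (:1 :- L))) refl x L (exp (- L))) ⟩
    x * L                            ∎
    where L = ln x

-- Real powers of nonnegative bases

module Powers {ℓ} (em : ExcludedMiddle ℓ) (ℝ : CompleteOrderedField ℓ) where

  open CompleteOrderedField ℝ
  open RealAnalysis em ℝ
  open OrderedField em ℝ
  open ExpLn em ℝ
  open IntegerCoefficients commutativeRing
  open PosetReasoning poset

  data ZeroOrPos (x : Carrier) : Set ℓ where
    isZero : x ≈ 0# → ZeroOrPos x
    isPos  : 0# < x → ZeroOrPos x

  zeroOrPos : ∀ {x} → 0# ≤ x → ZeroOrPos x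
  zeroOrPos {x} 0≤x with em {x ≈ 0#}
  ... | yes x≈0 = isZero x≈0
  ... | no  x≉0 = isPos (0≤x , λ 0≈x → x≉0 (sym 0≈x))

  ^ʳ-zero : ∀ {x} p → x ≈ 0# → x ^ʳ p ≈ 0#
  ^ʳ-zero {x} p x≈0 with em {x ≈ 0#}
  ... | yes _   = refl
  ... | no  x≉0 = contradiction x≈0 x≉0

  ^ʳ-pos : ∀ {x} p → 0# < x → x ^ʳ p ≈ exp (p * ln x)
  ^ʳ-pos {x} p 0<x with em {x ≈ 0#}
  ... | yes x≈0 = contradiction x≈0 (<⇒≉0 0<x)
  ... | no  _   = refl

  ^ʳ-nonNeg : ∀ x p → 0# ≤ x ^ʳ p
  ^ʳ-nonNeg x p with em {x ≈ 0#}
  ... | yes _ = ≤-refl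
  ... | no  _ = proj₁ (exp-pos _)

  ^ʳ-cong : ∀ {x y p q} → 0# ≤ x → x ≈ y → p ≈ q → x ^ʳ p ≈ y ^ʳ q
  ^ʳ-cong {x} {y} {p} {q} 0≤x x≈y p≈q with zeroOrPos 0≤x
  ... | isZero x≈0 = trans (^ʳ-zero p x≈0) (sym (^ʳ-zero q (trans (sym x≈y) x≈0)))
  ... | isPos 0<x  = begin-equality
    x ^ʳ p         ≈⟨ ^ʳ-pos p 0<x ⟩
    exp (p * ln x) ≈⟨ exp-cong (*-cong p≈q (ln-cong 0<x x≈y)) ⟩
    exp (q * ln y) ≈⟨ ^ʳ-pos q (<-≤-trans 0<x (≤-reflexive x≈y)) ⟨
    y ^ʳ q         ∎

  -- The convention that a zero base gives `0#` keeps monotonicity even at exponent zero, so that q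
  -- = 0, the case p = 1, needs no separate treatment.
  ^ʳ-mono : ∀ {x y p} → 0# ≤ p → 0# ≤ x → x ≤ y → x ^ʳ p ≤ y ^ʳ p
  ^ʳ-mono {x} {y} {p} 0≤p 0≤x x≤y with zeroOrPos 0≤x
  ... | isZero x≈0 = ≤-respˡ (sym (^ʳ-zero p x≈0)) (^ʳ-nonNeg y p)
  ... | isPos 0<x  = begin
    x ^ʳ p         ≈⟨ ^ʳ-pos p 0<x ⟩
    exp (p * ln x) ≤⟨ exp-mono (*-monoˡ-≤ 0≤p (ln-mono 0<x x≤y)) ⟩
    exp (p * ln y) ≈⟨ ^ʳ-pos p (<-≤-trans 0<x x≤y) ⟨
    y ^ʳ p         ∎

  ^ʳ-positive : ∀ {x} p → 0# < x → 0# < x ^ʳ p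
  ^ʳ-positive p 0<x = <-≤-trans (exp-pos _) (≤-reflexive (sym (^ʳ-pos p 0<x)))

  ^ʳ-distrib-* : ∀ {x y} p → 0# ≤ x → 0# ≤ y → (x * y) ^ʳ p ≈ x ^ʳ p * y ^ʳ p
  ^ʳ-distrib-* {x} {y} p 0≤x 0≤y with zeroOrPos 0≤x | zeroOrPos 0≤y
  ... | isZero x≈0 | _ = trans (^ʳ-zero p (trans (*-congʳ x≈0) (zeroˡ y)))
                           (sym (trans (*-congʳ (^ʳ-zero p x≈0)) (zeroˡ _)))
  ... | isPos _ | isZero y≈0 = trans (^ʳ-zero p (trans (*-congˡ y≈0) (zeroʳ x)))
                                 (sym (trans (*-congˡ (^ʳ-zero p y≈0)) (zeroʳ _)))
  ... | isPos 0<x | isPos 0<y = begin-equality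
    (x * y) ^ʳ p                    ≈⟨ ^ʳ-pos p (*-pos 0<x 0<y) ⟩
    exp (p * ln (x * y))            ≈⟨ exp-cong (trans (*-congˡ (ln-* 0<x 0<y)) (distribˡ p _ _)) ⟩
    exp (p * ln x + p * ln y)       ≈⟨ exp-+ _ _ ⟩
    exp (p * ln x) * exp (p * ln y) ≈⟨ *-cong (^ʳ-pos p 0<x) (^ʳ-pos p 0<y) ⟨
    x ^ʳ p * y ^ʳ p                 ∎

  ^ʳ-1 : ∀ {x} → 0# ≤ x → x ^ʳ 1# ≈ x
  ^ʳ-1 {x} 0≤x with zeroOrPos 0≤x
  ... | isZero x≈0 = trans (^ʳ-zero 1# x≈0) (sym x≈0)
  ... | isPos 0<x  = trans (^ʳ-pos 1# 0<x) (trans (exp-cong (*-identityˡ _)) (exp-ln 0<x))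

  ^ʳ-1+ : ∀ {x} q → 0# ≤ x → x ^ʳ (1# + q) ≈ x * x ^ʳ q
  ^ʳ-1+ {x} q 0≤x with zeroOrPos 0≤x
  ... | isZero x≈0 = trans (^ʳ-zero _ x≈0) (sym (trans (*-congʳ x≈0) (zeroˡ _)))
  ... | isPos 0<x  = begin-equality
    x ^ʳ (1# + q)           ≈⟨ ^ʳ-pos _ 0<x ⟩
    exp ((1# + q) * ln x)   ≈⟨ exp-cong (trans (distribʳ _ _ _) (+-congʳ (*-identityˡ _))) ⟩
    exp (ln x + q * ln x)   ≈⟨ exp-+ _ _ ⟩
    exp (ln x) * exp (q * ln x) ≈⟨ *-cong (exp-ln 0<x) (sym (^ʳ-pos q 0<x)) ⟩
    x * x ^ʳ q              ∎

  ^ʳ-assoc : ∀ {x} p r → 0# ≤ x → (x ^ʳ p) ^ʳ r ≈ x ^ʳ (p * r)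
  ^ʳ-assoc {x} p r 0≤x with zeroOrPos 0≤x
  ... | isZero x≈0 = trans (^ʳ-zero r (^ʳ-zero p x≈0)) (sym (^ʳ-zero _ x≈0))
  ... | isPos 0<x  = begin-equality
    (x ^ʳ p) ^ʳ r                ≈⟨ ^ʳ-pos r (^ʳ-positive p 0<x) ⟩
    exp (r * ln (x ^ʳ p))        ≈⟨ exp-cong (*-congˡ (trans
                                      (ln-cong (^ʳ-positive p 0<x) (^ʳ-pos p 0<x)) (ln-exp _))) ⟩
    exp (r * (p * ln x))         ≈⟨ exp-cong (solve 3 (λ r p l → r :* (p :* l) := p :* r :* l)
                                      refl r p (ln x)) ⟩
    exp (p * r * ln x)           ≈⟨ ^ʳ-pos _ 0<x ⟨
    x ^ʳ (p * r)                 ∎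

  -- Convexity comes from two linear bounds, w - 1 ≤ w ln w and 1 + t ≤ exp t at t = q ln w, in
  -- place of derivatives.
  ^ʳ-bernoulli : ∀ {w q} → 0# ≤ w → 0# ≤ q → 1# + (1# + q) * (w - 1#) ≤ w ^ʳ (1# + q)
  ^ʳ-bernoulli {w} {q} 0≤w 0≤q with zeroOrPos 0≤w
  ... | isZero w≈0 = begin
    1# + (1# + q) * (w - 1#)   ≈⟨ +-congˡ (*-congˡ (+-congʳ w≈0)) ⟩
    1# + (1# + q) * (0# - 1#)  ≤⟨ ≤-by 0≤q (solve 1 (λ q → :0 := :1 :+ (:1 :+ q) :* (:0 :- :1) :+ q) refl q) ⟩
    0#                         ≈⟨ ^ʳ-zero _ w≈0 ⟨
    w ^ʳ (1# + q)              ∎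
  ... | isPos 0<w = begin
    1# + (1# + q) * (w - 1#)   ≈⟨ solve 2 (λ w q → :1 :+ (:1 :+ q) :* (w :- :1) := w :+ q :* (w :- :1)) refl w q ⟩
    w + q * (w - 1#)           ≤⟨ +-monoʳ-≤ w (*-monoˡ-≤ 0≤q (x-1≤x*ln 0<w)) ⟩
    w + q * (w * ln w)         ≈⟨ solve 3 (λ w q l → w :+ q :* (w :* l) := w :* (:1 :+ q :* l)) refl w q (ln w) ⟩
    w * (1# + q * ln w)        ≤⟨ *-monoˡ-≤ 0≤w (1+x≤exp _) ⟩
    w * exp (q * ln w)         ≈⟨ *-congˡ (^ʳ-pos q 0<w) ⟨
    w * w ^ʳ q                 ≈⟨ ^ʳ-1+ q 0≤w ⟨
    w ^ʳ (1# + q)              ∎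

  -- Bernoulli's inequality at the ratio y / v, scaled by the power of `v`. At a zero `v` the
  -- convention makes the slope zero, also for q = 0, and only nonnegativity of a power is left.
  ^ʳ-tangent : ∀ {v y q} → 0# ≤ v → 0# ≤ y → 0# ≤ q →
               v ^ʳ (1# + q) + (1# + q) * v ^ʳ q * (y - v) ≤ y ^ʳ (1# + q)
  ^ʳ-tangent {v} {y} {q} 0≤v 0≤y 0≤q with zeroOrPos 0≤v
  ... | isZero v≈0 = begin
    v ^ʳ (1# + q) + (1# + q) * v ^ʳ q * (y - v)
      ≈⟨ +-cong (^ʳ-zero _ v≈0) (*-congʳ (*-congˡ (^ʳ-zero q v≈0))) ⟩
    0# + (1# + q) * 0# * (y - v)
      ≈⟨ solve 2 (λ p z → :0 :+ p :* :0 :* z := :0) refl (1# + q) (y - v) ⟩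
    0#
      ≤⟨ ^ʳ-nonNeg y _ ⟩
    y ^ʳ (1# + q) ∎
  ... | isPos 0<v = begin
    v ^ʳ (1# + q) + (1# + q) * v ^ʳ q * (y - v)
      ≈⟨ +-cong (^ʳ-1+ q 0≤v) (*-congˡ (+-congʳ (sym vw≈y))) ⟩
    v * v ^ʳ q + (1# + q) * v ^ʳ q * (v * w - v)
      ≈⟨ solve 4 (λ v V p w → v :* V :+ p :* V :* (v :* w :- v) := v :* V :* (:1 :+ p :* (w :- :1)))
           refl v (v ^ʳ q) (1# + q) w ⟩
    v * v ^ʳ q * (1# + (1# + q) * (w - 1#))
      ≤⟨ *-monoˡ-≤ (*-nonNeg 0≤v (^ʳ-nonNeg v q)) (^ʳ-bernoulli 0≤w 0≤q) ⟩
    v * v ^ʳ q * w ^ʳ (1# + q)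
      ≈⟨ *-congʳ (^ʳ-1+ q 0≤v) ⟨
    v ^ʳ (1# + q) * w ^ʳ (1# + q)
      ≈⟨ ^ʳ-distrib-* _ 0≤v 0≤w ⟨
    (v * w) ^ʳ (1# + q)
      ≈⟨ ^ʳ-cong (*-nonNeg 0≤v 0≤w) vw≈y refl ⟩
    y ^ʳ (1# + q) ∎
    where
    w = v ⁻¹ * y
    0≤w : 0# ≤ w
    0≤w = *-nonNeg (proj₁ (⁻¹-pos 0<v)) 0≤y
    vw≈y : v * w ≈ y
    vw≈y = trans (sym (*-assoc _ _ _)) (trans (*-congʳ (*-inverseʳ v (<⇒≉0 0<v))) (*-identityˡ y))

  -- Serves at r = 1 / p: taking the root of the factor 1 + C ε leaves a number that is at most this
  -- factor. `x≤^ʳ` does the corresponding work for 1 - C ε.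
  ^ʳ≤x : ∀ {x r} → 1# ≤ x → r ≤ 1# → x ^ʳ r ≤ x
  ^ʳ≤x {x} {r} 1≤x r≤1 = begin
    x ^ʳ r           ≈⟨ ^ʳ-pos r 0<x ⟩
    exp (r * ln x)   ≤⟨ exp-mono (≤-respʳ (*-identityˡ _)
                          (*-monoʳ-≤ (≤-respˡ ln-1 (ln-mono 0<1 1≤x)) r≤1)) ⟩
    exp (ln x)       ≈⟨ exp-ln 0<x ⟩
    x                ∎
    where 0<x = <-≤-trans 0<1 1≤x

  x≤^ʳ : ∀ {x r} → 0# ≤ x → x ≤ 1# → r ≤ 1# → x ≤ x ^ʳ r
  x≤^ʳ {x} {r} 0≤x x≤1 r≤1 with zeroOrPos 0≤x
  ... | isZero x≈0 = ≤-respˡ (sym x≈0) (^ʳ-nonNeg x r)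
  ... | isPos 0<x  = begin
    x                ≈⟨ exp-ln 0<x ⟨
    exp (ln x)       ≤⟨ exp-mono (≤-by
                          (*-nonNeg (x≤y⇒0≤y-x r≤1) (x≤0⇒0≤-x (≤-respʳ ln-1 (ln-mono 0<x x≤1))))
                          (solve 2 (λ r l → r :* l := l :+ (:1 :- r) :* :- l) refl r (ln x))) ⟩
    exp (r * ln x)   ≈⟨ ^ʳ-pos r 0<x ⟨
    x ^ʳ r           ∎

-- Absolute values and triangle inequalities

module AbsoluteValue {ℓ} (em : ExcludedMiddle ℓ) (ℝ : CompleteOrderedField ℓ) where

  open CompleteOrderedField ℝ hiding (zero)
  open RealAnalysis em ℝ
  open OrderedField em ℝ
  open IntegerCoefficients commutativeRing
  open Sum semiring using (sum)
  open PosetReasoning poset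

  ∣∣-nonNeg : ∀ x → 0# ≤ ∣ x ∣ʳ
  ∣∣-nonNeg x with total 0# x
  ... | inj₁ 0≤x = 0≤x
  ... | inj₂ x≤0 = x≤0⇒0≤-x x≤0

  x≤∣x∣ : ∀ x → x ≤ ∣ x ∣ʳ
  x≤∣x∣ x with total 0# x
  ... | inj₁ 0≤x = ≤-refl
  ... | inj₂ x≤0 = ≤-trans x≤0 (x≤0⇒0≤-x x≤0)

  -x≤∣x∣ : ∀ x → - x ≤ ∣ x ∣ʳ
  -x≤∣x∣ x with total 0# x
  ... | inj₁ 0≤x = ≤-trans (0≤-x⇒x≤0 (≤-respʳ (solve 1 (λ x → x := :- (:- x)) refl x) 0≤x)) 0≤x
  ... | inj₂ x≤0 = ≤-refl

  -- With `x≤∣x∣` and `-x≤∣x∣` this presents the absolute value as the maximum of `x` and `- x`,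
  -- independently of the branch that `total` takes at zero.
  ∣∣-least : ∀ {x b} → x ≤ b → - x ≤ b → ∣ x ∣ʳ ≤ b
  ∣∣-least {x} x≤b -x≤b with total 0# x
  ... | inj₁ _ = x≤b
  ... | inj₂ _ = -x≤b

  ∣∣-cong : ∀ {x y} → x ≈ y → ∣ x ∣ʳ ≈ ∣ y ∣ʳ
  ∣∣-cong {x} {y} x≈y = antisym
    (∣∣-least (≤-respˡ (sym x≈y) (x≤∣x∣ y)) (≤-respˡ (-‿cong (sym x≈y)) (-x≤∣x∣ y)))
    (∣∣-least (≤-respˡ x≈y (x≤∣x∣ x)) (≤-respˡ (-‿cong x≈y) (-x≤∣x∣ x)))

  ∣0∣≈0 : ∀ {x} → x ≈ 0# → ∣ x ∣ʳ ≈ 0#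
  ∣0∣≈0 {x} x≈0 = antisym
    (∣∣-least (≤-reflexive x≈0) (≤-reflexive (trans (-‿cong x≈0) (solve 0 (:- :0 := :0) refl))))
    (∣∣-nonNeg x)

  ∣∣-*ˡ : ∀ {c} x → 0# ≤ c → ∣ c * x ∣ʳ ≈ c * ∣ x ∣ʳ
  ∣∣-*ˡ {c} x 0≤c = antisym
    (∣∣-least (*-monoˡ-≤ 0≤c (x≤∣x∣ x)) (≤-respˡ
      (solve 2 (λ c x → c :* :- x := :- (c :* x)) refl c x) (*-monoˡ-≤ 0≤c (-x≤∣x∣ x))))
    c*∣x∣≤
    where
    c*∣x∣≤ : c * ∣ x ∣ʳ ≤ ∣ c * x ∣ʳ
    c*∣x∣≤ with total 0# x
    ... | inj₁ _ = x≤∣x∣ (c * x)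
    ... | inj₂ _ = ≤-respˡ (solve 2 (λ c x → :- (c :* x) := c :* :- x) refl c x) (-x≤∣x∣ (c * x))

  ∣∣-triangle : ∀ x y → ∣ x + y ∣ʳ ≤ ∣ x ∣ʳ + ∣ y ∣ʳ
  ∣∣-triangle x y = ∣∣-least (+-mono-≤ (x≤∣x∣ x) (x≤∣x∣ y)) (≤-respˡ
    (solve 2 (λ x y → :- x :+ :- y := :- (x :+ y)) refl x y) (+-mono-≤ (-x≤∣x∣ x) (-x≤∣x∣ y)))

  ∣∣-cancel-+ˡ : ∀ x y → ∣ y ∣ʳ ≤ ∣ x + y ∣ʳ + ∣ x ∣ʳ
  ∣∣-cancel-+ˡ x y = ∣∣-least
    (≤-respˡ (solve 2 (λ x y → (x :+ y) :+ :- x := y) refl x y)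
      (+-mono-≤ (x≤∣x∣ (x + y)) (-x≤∣x∣ x)))
    (≤-respˡ (solve 2 (λ x y → :- (x :+ y) :+ x := :- y) refl x y)
      (+-mono-≤ (-x≤∣x∣ (x + y)) (x≤∣x∣ x)))

  ∣sum∣≤sum∣∣ : ∀ {n} (z : Fin n → Carrier) → ∣ sum z ∣ʳ ≤ sum (λ i → ∣ z i ∣ʳ)
  ∣sum∣≤sum∣∣ {zero}  z = ≤-reflexive (∣0∣≈0 refl)
  ∣sum∣≤sum∣∣ {suc n} z = ≤-trans (∣∣-triangle _ _) (+-monoʳ-≤ _ (∣sum∣≤sum∣∣ (z ∘ suc)))

  -- The reverse triangle inequality, which bounds a term by the absolute value of the sum plus
  -- those of all other terms. Adding the term to both sides lets the right-hand sum run over every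
  -- index, so none has to be removed.
  twice-∣term∣ : ∀ {n} (z : Fin n → Carrier) m →
                 ∣ z m ∣ʳ + ∣ z m ∣ʳ ≤ ∣ sum z ∣ʳ + sum (λ i → ∣ z i ∣ʳ)
  twice-∣term∣ z zero = begin
    a + a                 ≤⟨ +-monoʳ-≤ a (∣∣-cancel-+ˡ S (z zero)) ⟩
    a + (∣ S + z zero ∣ʳ + ∣ S ∣ʳ) ≈⟨ +-congˡ (+-congʳ (∣∣-cong (+-comm S (z zero)))) ⟩
    a + (∣ sum z ∣ʳ + ∣ S ∣ʳ) ≤⟨ +-monoʳ-≤ a (+-monoʳ-≤ _ (∣sum∣≤sum∣∣ (z ∘ suc))) ⟩
    a + (∣ sum z ∣ʳ + T)  ≈⟨ solve 3 (λ a s t → a :+ (s :+ t) := s :+ (a :+ t)) refl a _ T ⟩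
    ∣ sum z ∣ʳ + (a + T)  ∎
    where
    a = ∣ z zero ∣ʳ
    S = sum (z ∘ suc)
    T = sum (λ i → ∣ z (suc i) ∣ʳ)
  twice-∣term∣ z (suc m) = begin
    ∣ z (suc m) ∣ʳ + ∣ z (suc m) ∣ʳ       ≤⟨ twice-∣term∣ (z ∘ suc) m ⟩
    ∣ sum (z ∘ suc) ∣ʳ + T                ≤⟨ +-mono-≤ (∣∣-cancel-+ˡ (z zero) _) ≤-refl ⟩
    ∣ sum z ∣ʳ + ∣ z zero ∣ʳ + T          ≈⟨ +-assoc _ _ _ ⟩
    ∣ sum z ∣ʳ + (∣ z zero ∣ʳ + T)        ∎
    where T = sum (λ i → ∣ z (suc i) ∣ʳ)

-- A single row: the power of a sum against the power of its largest term

module Rows {ℓ} (em : ExcludedMiddle ℓ) (ℝ : CompleteOrderedField ℓ) where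

  open CompleteOrderedField ℝ hiding (zero)
  open RealAnalysis em ℝ
  open OrderedField em ℝ
  open ExpLn em ℝ
  open Powers em ℝ
  open AbsoluteValue em ℝ
  open IntegerCoefficients commutativeRing
  open Sum semiring using (sum)
  open PosetReasoning poset

  sum-+* : ∀ {n} (f g : Fin n → Carrier) c → sum (λ i → f i + c * g i) ≈ sum f + c * sum g
  sum-+* {zero}  f g c = solve 1 (λ c → :0 := :0 :+ c :* :0) refl c
  sum-+* {suc n} f g c = trans (+-congˡ (sum-+* (f ∘ suc) (g ∘ suc) c))
    (solve 5 (λ f g c F G → f :+ c :* g :+ (F :+ c :* G) := f :+ F :+ c :* (g :+ G))
      refl (f zero) (g zero) c _ _)

  -- In `K` the 3 bounds p, the single `e` bounds the factor nᵠ in the slope of the tangent, and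
  -- `e * e` bounds the factor (n²)ᵠ in `young`.
  e K : Carrier
  e = exp 1#
  K = (1# + (1# + 1#)) * e * (e * e)

  1≤e : 1# ≤ e
  1≤e = ≤-trans (x≤x+y 0≤1) (1+x≤exp 1#)

  0≤e : 0# ≤ e
  0≤e = ≤-trans 0≤1 1≤e

  0≤3 : 0# ≤ 1# + (1# + 1#)
  0≤3 = +-nonNeg 0≤1 0≤2

  0≤K : 0# ≤ K
  0≤K = *-nonNeg (*-nonNeg 0≤3 0≤e) (*-nonNeg 0≤e 0≤e)

  1≤e² : 1# ≤ e * e
  1≤e² = ≤-respˡ (*-identityˡ 1#) (*-mono-≤ 0≤e 0≤1 1≤e 1≤e)

  module _ {l} {p q ε : Carrier}
           (p≈1+q : p ≈ 1# + q) (0≤q : 0# ≤ q) (q≤2 : q ≤ 1# + 1#)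
           (N^q≤e : fromℕ (suc l) ^ʳ q ≤ e) (N⁻¹≤ε : fromℕ (suc l) ⁻¹ ≤ ε) where

    private
      n : ℕ
      n = suc l

      N : Carrier
      N = fromℕ n

      0≤p : 0# ≤ p
      0≤p = ≤-respʳ (sym p≈1+q) (+-nonNeg 0≤1 0≤q)

      p≤3 : p ≤ 1# + (1# + 1#)
      p≤3 = ≤-respˡ (sym p≈1+q) (+-monoʳ-≤ 1# q≤2)

      ^p≈ : ∀ {x} → 0# ≤ x → x ^ʳ p ≈ x * x ^ʳ q
      ^p≈ 0≤x = trans (^ʳ-cong 0≤x refl p≈1+q) (^ʳ-1+ q 0≤x)

      -- The tangent at `v`, solved for the power of `v`. Both row bounds use it, with `v` the
      -- larger of s and a.
      tangent : ∀ {v y} → 0# ≤ v → 0# ≤ y → v ^ʳ p ≤ y ^ʳ p + p * v ^ʳ q * (v - y)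
      tangent {v} {y} 0≤v 0≤y = begin
        v ^ʳ p
          ≈⟨ ^ʳ-cong 0≤v refl p≈1+q ⟩
        v ^ʳ (1# + q)
          ≈⟨ solve 4 (λ V P v y → V := V :+ P :* (y :- v) :+ P :* (v :- y)) refl _ ((1# + q) * v ^ʳ q) v y ⟩
        v ^ʳ (1# + q) + (1# + q) * v ^ʳ q * (y - v) + (1# + q) * v ^ʳ q * (v - y)
          ≤⟨ +-mono-≤ (^ʳ-tangent 0≤v 0≤y 0≤q) ≤-refl ⟩
        y ^ʳ (1# + q) + (1# + q) * v ^ʳ q * (v - y)
          ≈⟨ +-cong (^ʳ-cong 0≤y refl p≈1+q) (*-congʳ (*-congʳ p≈1+q)) ⟨
        y ^ʳ p + p * v ^ʳ q * (v - y) ∎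

      0<N : 0# < N
      0<N = fromℕ-pos l

      N*N⁻¹≈1 : N * N ⁻¹ ≈ 1#
      N*N⁻¹≈1 = *-inverseʳ N (<⇒≉0 0<N)

      ν² : Carrier
      ν² = N ⁻¹ * N ⁻¹

      0≤ν² : 0# ≤ ν²
      0≤ν² = *-nonNeg (proj₁ (⁻¹-pos 0<N)) (proj₁ (⁻¹-pos 0<N))

      [Nx]^q≤e*x^q : ∀ {x} → 0# ≤ x → (N * x) ^ʳ q ≤ e * x ^ʳ q
      [Nx]^q≤e*x^q {x} 0≤x = ≤-respˡ (sym (^ʳ-distrib-* q (proj₁ 0<N) 0≤x))
        (*-monoʳ-≤ (^ʳ-nonNeg x q) N^q≤e)

      -- A form of Young's inequality: giving the first power a weight δ costs δ⁻ᵠ on the second,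
      -- and δ = `ν²` keeps this cost at (n²)ᵠ ≤ e². Each of the two cases needs only one of the two
      -- summands.
      young : ∀ {a y} → 0# ≤ a → 0# ≤ y → a ^ʳ q * y ≤ ν² * a ^ʳ p + e * e * y ^ʳ p
      young {a} {y} 0≤a 0≤y with total y (ν² * a)
      ... | inj₁ y≤ν²a = begin
        a ^ʳ q * y            ≤⟨ *-monoˡ-≤ (^ʳ-nonNeg a q) y≤ν²a ⟩
        a ^ʳ q * (ν² * a)     ≈⟨ solve 3 (λ A ν a → A :* (ν :* a) := ν :* (a :* A)) refl _ ν² a ⟩
        ν² * (a * a ^ʳ q)     ≈⟨ *-congˡ (^p≈ 0≤a) ⟨
        ν² * a ^ʳ p           ≤⟨ x≤x+y (*-nonNeg (*-nonNeg 0≤e 0≤e) (^ʳ-nonNeg y p)) ⟩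
        ν² * a ^ʳ p + e * e * y ^ʳ p ∎
      ... | inj₂ ν²a≤y = begin
        a ^ʳ q * y            ≤⟨ *-monoʳ-≤ 0≤y (begin
          a ^ʳ q                  ≤⟨ ^ʳ-mono 0≤q 0≤a a≤N²y ⟩
          (N * (N * y)) ^ʳ q      ≤⟨ [Nx]^q≤e*x^q (*-nonNeg (proj₁ 0<N) 0≤y) ⟩
          e * (N * y) ^ʳ q        ≤⟨ *-monoˡ-≤ 0≤e ([Nx]^q≤e*x^q 0≤y) ⟩
          e * (e * y ^ʳ q)        ∎) ⟩
        e * (e * y ^ʳ q) * y  ≈⟨ solve 3 (λ e Y y → e :* (e :* Y) :* y := e :* e :* (y :* Y)) refl e _ y ⟩
        e * e * (y * y ^ʳ q)  ≈⟨ *-congˡ (^p≈ 0≤y) ⟨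
        e * e * y ^ʳ p        ≤⟨ y≤x+y (*-nonNeg 0≤ν² (^ʳ-nonNeg a p)) ⟩
        ν² * a ^ʳ p + e * e * y ^ʳ p ∎
        where
        a≤N²y : a ≤ N * (N * y)
        a≤N²y = begin
          a                            ≈⟨ solve 1 (λ a → a := :1 :* (:1 :* a)) refl a ⟩
          1# * (1# * a)                ≈⟨ *-cong N*N⁻¹≈1 (*-congʳ N*N⁻¹≈1) ⟨
          N * N ⁻¹ * (N * N ⁻¹ * a)    ≈⟨ solve 3 (λ N i a → N :* i :* (N :* i :* a) :=
                                                     N :* (N :* (i :* i :* a))) refl N (N ⁻¹) a ⟩
          N * (N * (ν² * a))           ≤⟨ *-monoˡ-≤ (proj₁ 0<N) (*-monoˡ-≤ (proj₁ 0<N) ν²a≤y) ⟩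
          N * (N * y)                  ∎

    module Row (z : Fin n → Carrier) m (max : ∀ i → ∣ z i ∣ʳ ≤ ∣ z m ∣ʳ) where

      private
        a s r T : Carrier
        a = ∣ z m ∣ʳ
        s = ∣ sum z ∣ʳ
        T = sum λ i → ∣ z i ∣ʳ
        r = T - a

        0≤a : 0# ≤ a
        0≤a = ∣∣-nonNeg (z m)

        0≤s : 0# ≤ s
        0≤s = ∣∣-nonNeg (sum z)

      A V : Carrier
      A = a ^ʳ p
      V = sum λ i → ∣ z i ∣ʳ ^ʳ p

      A≤V : A ≤ V
      A≤V = term≤sum (λ i → ^ʳ-nonNeg (∣ z i ∣ʳ) p) m

      private
        0≤A : 0# ≤ A
        0≤A = ^ʳ-nonNeg a p

        0≤ε : 0# ≤ ε
        0≤ε = ≤-trans (proj₁ (⁻¹-pos 0<N)) N⁻¹≤ε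

        s-a≤r : s - a ≤ r
        s-a≤r = +-mono-≤ (∣sum∣≤sum∣∣ z) ≤-refl

        a-s≤r : a - s ≤ r
        a-s≤r = ≤-by (x≤y⇒0≤y-x (twice-∣term∣ z m))
          (solve 3 (λ a s t → t :- a := a :- s :+ (s :+ t :- (a :+ a))) refl a s T)

        0≤r : 0# ≤ r
        0≤r = x≤y⇒0≤y-x (term≤sum (∣∣-nonNeg ∘ z) m)

        s≤Na : s ≤ N * a
        s≤Na = ≤-trans (∣sum∣≤sum∣∣ z) (≤-respʳ (sum-const n a) (sum-mono max))

        -- The error budget of the row: added over all rows, each of the two summands is at most ε d
        -- ‖x‖ᵖ.
        B : Carrier
        B = ε * A + (V - A)

        -- The sum of Young's inequality over i ≠ m, in the form h m ≤ Σ h.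
        a^q*r≤ : a ^ʳ q * r ≤ e * e * B
        a^q*r≤ = begin
          a ^ʳ q * r
            ≤⟨ x≤x+y (*-nonNeg (x≤y⇒0≤y-x N⁻¹≤ε) 0≤A) ⟩
          a ^ʳ q * r + (ε - N ⁻¹) * A
            ≤⟨ +-mono-≤ a^q*r≤′ ≤-refl ⟩
          N ⁻¹ * A + e * e * (V - A) + (ε - N ⁻¹) * A
            ≈⟨ solve 5 (λ i A E V ε → i :* A :+ E :* (V :- A) :+ (ε :- i) :* A :=
                          ε :* A :+ E :* (V :- A)) refl (N ⁻¹) A (e * e) V ε ⟩
          ε * A + e * e * (V - A)
            ≤⟨ ≤-by (*-nonNeg (x≤y⇒0≤y-x 1≤e²) (*-nonNeg 0≤ε 0≤A))
                 (solve 4 (λ A E V ε → E :* (ε :* A :+ (V :- A)) :=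
                    ε :* A :+ E :* (V :- A) :+ (E :- :1) :* (ε :* A)) refl A (e * e) V ε) ⟩
          e * e * B ∎
          where
          h : Fin n → Carrier
          h i = (ν² * A + e * e * ∣ z i ∣ʳ ^ʳ p) + - (a ^ʳ q) * ∣ z i ∣ʳ

          0≤h : ∀ i → 0# ≤ h i
          0≤h i = ≤-respʳ (+-congˡ (solve 2 (λ A z → :- (A :* z) := (:- A) :* z) refl _ _))
            (x≤y⇒0≤y-x (young 0≤a (∣∣-nonNeg (z i))))

          sum-h : sum h ≈ N ⁻¹ * A + e * e * V - a ^ʳ q * T
          sum-h = begin-equality
            sum h
              ≈⟨ trans (sum-+* (λ i → ν² * A + e * e * ∣ z i ∣ʳ ^ʳ p) (λ i → ∣ z i ∣ʳ) (- (a ^ʳ q)))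
                   (+-congʳ (sum-+* (λ _ → ν² * A) (λ i → ∣ z i ∣ʳ ^ʳ p) (e * e))) ⟩
            sum {n} (λ _ → ν² * A) + e * e * V + - (a ^ʳ q) * T
              ≈⟨ +-congʳ (+-congʳ (sum-const n (ν² * A))) ⟩
            N * (ν² * A) + e * e * V + - (a ^ʳ q) * T
              ≈⟨ solve 6 (λ N i A E Q T → N :* (i :* i :* A) :+ E :+ (:- Q) :* T :=
                            N :* i :* (i :* A) :+ E :- Q :* T)
                   refl N (N ⁻¹) A (e * e * V) (a ^ʳ q) T ⟩
            N * N ⁻¹ * (N ⁻¹ * A) + e * e * V - a ^ʳ q * T
              ≈⟨ +-congʳ (+-congʳ (trans (*-congʳ N*N⁻¹≈1) (*-identityˡ _))) ⟩
            N ⁻¹ * A + e * e * V - a ^ʳ q * T ∎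

          -- Retaining the term at `m`, rather than just 0 ≤ Σ h, produces `V - A` in place of `V`;
          -- only the difference is small after summation over the rows.
          e²A-A≤h : e * e * A + - (a ^ʳ q) * a ≤ sum h
          e²A-A≤h = ≤-trans (+-mono-≤ (y≤x+y (*-nonNeg 0≤ν² 0≤A)) ≤-refl) (term≤sum 0≤h m)

          a^q*r≤′ : a ^ʳ q * r ≤ N ⁻¹ * A + e * e * (V - A)
          a^q*r≤′ = ≤-by (x≤y⇒0≤y-x (≤-respʳ sum-h e²A-A≤h))
            (solve 7 (λ Q T a i A E V → i :* A :+ E :* (V :- A) :=
                Q :* (T :- a) :+ (i :* A :+ E :* V :- Q :* T :- (E :* A :+ (:- Q) :* a)))
              refl (a ^ʳ q) T a (N ⁻¹) A (e * e) V)

        -- Here `u` is sᵠ or aᵠ, and `v` the gap between s and a. Admitting `u` up to e aᵠ lets both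
        -- row bounds share the estimate.
        p*u*v≤K*B : ∀ {u v} → 0# ≤ u → u ≤ e * a ^ʳ q → v ≤ r → p * u * v ≤ K * B
        p*u*v≤K*B {u} {v} 0≤u u≤ v≤r = begin
          p * u * v
            ≤⟨ *-monoˡ-≤ (*-nonNeg 0≤p 0≤u) v≤r ⟩
          p * u * r
            ≤⟨ *-monoʳ-≤ 0≤r (*-mono-≤ 0≤3 0≤u p≤3 u≤) ⟩
          (1# + (1# + 1#)) * (e * a ^ʳ q) * r
            ≈⟨ solve 4 (λ t e Q r → t :* (e :* Q) :* r := t :* e :* (Q :* r)) refl _ e (a ^ʳ q) r ⟩
          (1# + (1# + 1#)) * e * (a ^ʳ q * r)
            ≤⟨ *-monoˡ-≤ (*-nonNeg 0≤3 0≤e) a^q*r≤ ⟩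
          (1# + (1# + 1#)) * e * (e * e * B)
            ≈⟨ *-assoc _ _ _ ⟨
          K * B ∎

        0≤KB : 0# ≤ K * B
        0≤KB = *-nonNeg 0≤K (+-nonNeg (*-nonNeg 0≤ε 0≤A) (x≤y⇒0≤y-x A≤V))

      row-upper : s ^ʳ p ≤ A + K * (ε * A + (V - A))
      row-upper with total a s
      ... | inj₁ a≤s = ≤-trans (tangent 0≤s 0≤a) (+-monoʳ-≤ A
        (p*u*v≤K*B (^ʳ-nonNeg s q) (≤-trans (^ʳ-mono 0≤q 0≤s s≤Na) ([Nx]^q≤e*x^q 0≤a)) s-a≤r))
      ... | inj₂ s≤a = ≤-trans (^ʳ-mono 0≤p 0≤s s≤a) (x≤x+y 0≤KB)

      row-lower : A ≤ s ^ʳ p + K * (ε * A + (V - A))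
      row-lower with total a s
      ... | inj₁ a≤s = ≤-trans (^ʳ-mono 0≤p 0≤a a≤s) (x≤x+y 0≤KB)
      ... | inj₂ s≤a = ≤-trans (tangent 0≤a 0≤s) (+-monoʳ-≤ (s ^ʳ p)
        (p*u*v≤K*B (^ʳ-nonNeg a q)
          (≤-respˡ (*-identityˡ _) (*-monoʳ-≤ (^ʳ-nonNeg a q) 1≤e)) a-s≤r))

-- Expansion for weighted vertex sets and double counting

module Expander {ℓ} (em : ExcludedMiddle ℓ) (ℝ : CompleteOrderedField ℓ) where

  open CompleteOrderedField ℝ hiding (zero)
  open RealAnalysis em ℝ
  open OrderedField em ℝ
  open Rows em ℝ
  open IntegerCoefficients commutativeRing
  open Sum semiring using (sum; sum-cong-≋; *-distribˡ-sum; ∑-comm)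
  open PosetReasoning poset

  -- `indicator (G i) j` unfolds to the same term as `adjacency G j i`, so facts about indicators
  -- apply to columns of the matrix.
  indicator : ∀ {n} → Subset n → Fin n → Carrier
  indicator X i = if does (i ∈? X) then 1# else 0#

  indicator-∈ : ∀ {n} {X : Subset n} {i} → i ∈ X → indicator X i ≈ 1#
  indicator-∈ {X = X} {i} i∈X =
    reflexive (≡.cong (λ b → if b then 1# else 0#) (dec-true (i ∈? X) i∈X))

  indicator-∉ : ∀ {n} {X : Subset n} {i} → i ∉ X → indicator X i ≈ 0#
  indicator-∉ {X = X} {i} i∉X =
    reflexive (≡.cong (λ b → if b then 1# else 0#) (dec-false (i ∈? X) i∉X))

  indicator-nonNeg : ∀ {n} (X : Subset n) i → 0# ≤ indicator X i
  indicator-nonNeg X i with i ∈? X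
  ... | yes _ = 0≤1
  ... | no  _ = ≤-refl

  sum-indicator : ∀ {n} (X : Subset n) → sum (indicator X) ≈ fromℕ ∣ X ∣
  sum-indicator []            = refl
  sum-indicator (inside  ∷ X) = +-congˡ (sum-indicator X)
  sum-indicator (outside ∷ X) = trans (+-identityˡ _) (sum-indicator X)

  argminOn : ∀ {n} (w : Fin n → Carrier) (X : Subset n) → Nonempty X →
             ∃ λ m → m ∈ X × (∀ {i} → i ∈ X → w m ≤ w i)
  argminOn w (outside ∷ X) (suc i , there i∈X) =
    let m , m∈X , min = argminOn (w ∘ suc) X (i , i∈X) in
    suc m , there m∈X , λ { (there j∈X) → min j∈X }
  argminOn w (inside ∷ X) _ with nonempty? X
  ... | no empty = zero , here , λ { here → ≤-refl ; (there j∈X) → contradiction (_ , j∈X) empty }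
  ... | yes nonempty with argminOn (w ∘ suc) X nonempty
  ...   | m , m∈X , min with total (w zero) (w (suc m))
  ...     | inj₁ w₀≤ = zero , here , λ { here → ≤-refl ; (there j∈X) → ≤-trans w₀≤ (min j∈X) }
  ...     | inj₂ ≤w₀ = suc m , there m∈X , λ { here → ≤w₀ ; (there j∈X) → min j∈X }

  module _ {n m} (G : BipartiteGraph n m) where

    private
      neighbour? : ∀ X j → Dec (∃ λ i → i ∈ X × j ∈ G i)
      neighbour? X j = Fin.any? λ i → (i ∈? X) ×-dec (j ∈? G i)

    ∈-neighbourhood : ∀ {X i j} → i ∈ X → j ∈ G i → j ∈ neighbourhood G X
    ∈-neighbourhood {X} {i} {j} i∈X j∈Gi = lookup⇒[]= j _
      (≡.trans (lookup∘tabulate _ j) (dec-true (neighbour? X j) (i , i∈X , j∈Gi)))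

    neighbourhood-∈ : ∀ {X j} → j ∈ neighbourhood G X → ∃ λ i → i ∈ X × j ∈ G i
    neighbourhood-∈ {X} {j} j∈N with neighbour? X j
    ... | yes p = p
    ... | no ¬p = contradiction
      (≡.trans (≡.sym (dec-false (neighbour? X j) ¬p))
        (≡.trans (≡.sym (lookup∘tabulate _ j)) ([]=⇒lookup j∈N))) λ ()

  module _ {n m k d ε} {G : BipartiteGraph n m} (expander : IsUnbalancedExpander k ε d G) where

    open IsUnbalancedExpander expander

    private
      c : Carrier
      c = (1# - ε) * fromℕ d

    -- A layer-cake argument: subtracting the smallest value δ of w on X from w on X
    -- and from A on the neighbourhood of X costs what the expansion of X pays for, and
    -- a point where w attains δ can then be removed from X.
    expansion-weighted : ∀ s (X : Subset n) → ∣ X ∣ ℕ.≤ s → ∣ X ∣ ℕ.≤ k →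
      ∀ (w : Fin n → Carrier) (A : Fin m → Carrier) →
      (∀ i → 0# ≤ w i) → (∀ {i} → i ∉ X → w i ≈ 0#) →
      (∀ j → 0# ≤ A j) → (∀ {i j} → j ∈ G i → w i ≤ A j) →
      c * sum w ≤ sum A
    expansion-weighted s X ∣X∣≤s ∣X∣≤k w A 0≤w w≈0 0≤A w≤A with nonempty? X
    ... | no empty = ≤-respˡ (sym (begin-equality
      c * sum w      ≈⟨ *-congˡ (sum-cong-≋ {n} {w} {λ _ → 0#} λ i → w≈0 λ i∈X → empty (i , i∈X)) ⟩
      c * sum {n} (λ _ → 0#)   ≈⟨ *-congˡ (sum-const n 0#) ⟩
      c * (fromℕ n * 0#)       ≈⟨ solve 2 (λ c n → c :* (n :* :0) := :0) refl c (fromℕ n) ⟩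
      0#             ∎)) (sum-nonNeg 0≤A)
    -- `s` bounds the number of rounds: every round removes a vertex from `X`, so a nonempty `X`
    -- never meets `s = 0`.
    expansion-weighted zero X ∣X∣≤0 _ w A _ _ _ _ | yes (i , i∈X) =
      contradiction (ℕ.≤-trans (x∈p⇒∣p-x∣<∣p∣ i∈X) ∣X∣≤0) λ ()
    expansion-weighted (suc s) X ∣X∣≤s ∣X∣≤k w A 0≤w w≈0 0≤A w≤A | yes nonempty
      with i₀ , i₀∈X , min ← argminOn w X nonempty = begin
        c * sum w
          ≈⟨ solve 4 (λ c w δ x → c :* w := c :* (w :+ (:- δ) :* x) :+ δ :* (c :* x)) refl c _ δ _ ⟩
        c * (sum w + - δ * sum (indicator X)) + δ * (c * sum (indicator X))
          ≈⟨ +-cong (*-congˡ (sum-+* w (indicator X) (- δ))) (*-congˡ (*-congˡ (sym (sum-indicator X)))) ⟨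
        c * sum w′ + δ * (c * fromℕ ∣ X ∣)
          ≤⟨ +-mono-≤ ih (*-monoˡ-≤ (0≤w i₀) (expanding X ∣X∣≤k)) ⟩
        sum A′ + δ * fromℕ ∣ Y ∣
          ≈⟨ +-cong (sum-+* A (indicator Y) (- δ)) (*-congˡ (sym (sum-indicator Y))) ⟩
        sum A + - δ * sum (indicator Y) + δ * sum (indicator Y)
          ≈⟨ solve 3 (λ a δ y → a :+ (:- δ) :* y :+ δ :* y := a) refl _ δ _ ⟩
        sum A ∎
      where
      Y : Subset m
      Y = neighbourhood G X

      δ : Carrier
      δ = w i₀

      w′ : Fin n → Carrier
      w′ i = w i + - δ * indicator X i

      A′ : Fin m → Carrier
      A′ j = A j + - δ * indicator Y j

      w′-∉ : ∀ {i} → i ∉ X → w′ i ≈ 0#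
      w′-∉ i∉X = trans (+-cong (w≈0 i∉X) (*-congˡ (indicator-∉ i∉X)))
        (solve 1 (λ δ → :0 :+ (:- δ) :* :0 := :0) refl δ)

      A′-∈ : ∀ {j} → j ∈ Y → A′ j ≈ A j - δ
      A′-∈ j∈Y = +-congˡ (trans (*-congˡ (indicator-∈ j∈Y)) (*-identityʳ _))

      0≤w′ : ∀ i → 0# ≤ w′ i
      0≤w′ i with i ∈? X
      ... | yes i∈X = ≤-respʳ (+-congˡ (sym (*-identityʳ _))) (x≤y⇒0≤y-x (min i∈X))
      ... | no  i∉X = ≤-respʳ (solve 2 (λ w δ → w := w :+ (:- δ) :* :0) refl _ δ) (0≤w i)

      w′≈0 : ∀ {i} → i ∉ X ∖ i₀ → w′ i ≈ 0#
      w′≈0 {i} i∉ with i ∈? X | i Fin.≟ i₀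
      ... | no  i∉X | _          = trans (+-congʳ (w≈0 i∉X)) (solve 1 (λ δ → :0 :+ (:- δ) :* :0 := :0) refl δ)
      ... | yes _   | yes ≡.refl = solve 1 (λ δ → δ :+ (:- δ) :* :1 := :0) refl δ
      ... | yes i∈X | no  i≢i₀   = contradiction (x∈p∧x≢y⇒x∈p-y i∈X i≢i₀) i∉

      0≤A′ : ∀ j → 0# ≤ A′ j
      0≤A′ j with j ∈? Y
      ... | no  _   = ≤-respʳ (solve 2 (λ a δ → a := a :+ (:- δ) :* :0) refl _ δ) (0≤A j)
      ... | yes j∈Y =
        let i , i∈X , j∈Gi = neighbourhood-∈ G j∈Y in
        ≤-respʳ (+-congˡ (sym (*-identityʳ _))) (x≤y⇒0≤y-x (≤-trans (min i∈X) (w≤A j∈Gi)))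

      w′≤A′ : ∀ {i j} → j ∈ G i → w′ i ≤ A′ j
      w′≤A′ {i} {j} j∈Gi with i ∈? X
      ... | yes i∈X = ≤-respˡ (+-congˡ (sym (*-identityʳ _)))
        (≤-respʳ (sym (A′-∈ (∈-neighbourhood G i∈X j∈Gi))) (+-mono-≤ (w≤A j∈Gi) ≤-refl))
      -- Outside `X` the lowered weight is zero, so the nonnegativity of the lowered `A` is enough,
      -- whether or not j lies in `Y`.
      ... | no  i∉X = ≤-respˡ (trans (sym (w′-∉ i∉X)) (+-congˡ (*-congˡ (indicator-∉ i∉X)))) (0≤A′ j)

      ih : c * sum w′ ≤ sum A′
      ih = expansion-weighted s (X ∖ i₀)
        (ℕ.≤-pred (ℕ.≤-trans (x∈p⇒∣p-x∣<∣p∣ i₀∈X) ∣X∣≤s))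
        (ℕ.≤-trans (ℕ.<⇒≤ (x∈p⇒∣p-x∣<∣p∣ i₀∈X)) ∣X∣≤k)
        w′ A′ 0≤w′ w′≈0 0≤A′ w′≤A′

    -- Exchanging the sums leaves column sums of the adjacency matrix, and each column has exactly
    -- `d` ones.
    sum-adjacency : ∀ (u : Fin n → Carrier) →
                    sum (λ j → sum λ i → adjacency G j i * u i) ≈ fromℕ d * sum u
    sum-adjacency u = begin-equality
      sum (λ j → sum λ i → adjacency G j i * u i)
        ≈⟨ ∑-comm (λ j i → adjacency G j i * u i) ⟩
      sum (λ i → sum λ j → adjacency G j i * u i)
        ≈⟨ sum-cong-≋ {n} (λ i → begin-equality
             sum (λ j → indicator (G i) j * u i)   ≈⟨ Sum.*-distribʳ-sum semiring (u i) (indicator (G i)) ⟨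
             sum (indicator (G i)) * u i           ≈⟨ *-congʳ (sum-indicator (G i)) ⟩
             fromℕ ∣ G i ∣ * u i                   ≡⟨ ≡.cong (λ t → fromℕ t * u i) (leftRegular i) ⟩
             fromℕ d * u i                         ∎) ⟩
      sum (λ i → fromℕ d * u i)
        ≈⟨ *-distribˡ-sum (fromℕ d) u ⟨
      fromℕ d * sum u ∎

    ∉-support : ∀ (x : Vector Carrier n) {i} → i ∉ support x → x i ≈ 0#
    ∉-support x {i} i∉ with em {x i ≈ 0#} in eq
    ... | yes xi≈0 = xi≈0
    ... | no  xi≉0 = contradiction (lookup⇒[]= i _
      (≡.trans (lookup∘tabulate _ i) (≡.cong (does ∘ ¬?) eq))) i∉

    expansion : ∀ {x : Vector Carrier n} → IsSparse k x →
      ∀ (w : Fin n → Carrier) (A : Fin m → Carrier) →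
      (∀ i → 0# ≤ w i) → (∀ {i} → x i ≈ 0# → w i ≈ 0#) →
      (∀ j → 0# ≤ A j) → (∀ {i j} → j ∈ G i → w i ≤ A j) →
      c * sum w ≤ sum A
    expansion {x} sparse w A 0≤w w≈0 =
      expansion-weighted ∣ support x ∣ (support x) ℕ.≤-refl sparse w A 0≤w (w≈0 ∘ ∉-support x)

-- From row estimates and expansion to bounds on norms

module Isometry {ℓ} (em : ExcludedMiddle ℓ) (ℝ : CompleteOrderedField ℓ) where

  open CompleteOrderedField ℝ hiding (zero)
  open RealAnalysis em ℝ
  open OrderedField em ℝ
  open ExpLn em ℝ
  open Powers em ℝ
  open AbsoluteValue em ℝ
  open Rows em ℝ
  open Expander em ℝ
  open IntegerCoefficients commutativeRing
  open Sum semiring using (sum; sum-cong-≋; *-distribˡ-sum; ∑-distrib-+)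
  open PosetReasoning poset

  -- The summand `1#` pays for the factor 1 - ε that expansion loses on the largest terms, and
  -- `K + K` for the summed row errors.
  C : Carrier
  C = 1# + (K + K)

  1<C : 1# < C
  1<C = ≰⇒> λ C≤1 → <⇒≱ (<-≤-trans 0<K (x≤x+y 0≤K)) (0≤-x⇒x≤0 (≤-respʳ
    (solve 1 (λ k → :1 :- (:1 :+ k) := :- k) refl (K + K)) (x≤y⇒0≤y-x C≤1)))
    where
    0<K : 0# < K
    0<K = *-pos (*-pos (<-≤-trans 0<1 (x≤x+y 0≤2)) (exp-pos 1#)) (*-pos (exp-pos 1#) (exp-pos 1#))

  ‖‖-1 : ∀ {n} (y : Vector Carrier n) → ‖ y ‖[ 1# ] ≈ sum (λ i → ∣ y i ∣ʳ)
  ‖‖-1 y = begin-equality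
    sum (λ i → ∣ y i ∣ʳ ^ʳ 1#) ^ʳ (1# ⁻¹)
      ≈⟨ ^ʳ-cong (sum-nonNeg λ i → ^ʳ-nonNeg (∣ y i ∣ʳ) 1#) (sum-cong-≋ λ i → ^ʳ-1 (∣∣-nonNeg (y i))) 1⁻¹≈1 ⟩
    sum (λ i → ∣ y i ∣ʳ) ^ʳ 1#
      ≈⟨ ^ʳ-1 (sum-nonNeg λ i → ∣∣-nonNeg (y i)) ⟩
    sum (λ i → ∣ y i ∣ʳ) ∎

  module _ {n : ℕ} {p} (2≤n : 2 ℕ.≤ n) (1≤p : 1# ≤ p) (p≤ : p ≤ 1# + ln (fromℕ n) ⁻¹) where

    private
      N L q : Carrier
      N = fromℕ n
      L = ln N
      q = p - 1#

      2≤N : 1# + 1# ≤ N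
      2≤N = ≤-respˡ fromℕ-2 (fromℕ-mono 2≤n)

      0<N : 0# < N
      0<N = <-≤-trans 0<2 2≤N

    0≤p-1 : 0# ≤ p - 1#
    0≤p-1 = x≤y⇒0≤y-x 1≤p

    private
      -- Because ln N ≥ 1 - 1 / N and N ≥ 2. This crude lower bound for the logarithm is the source
      -- of `p-1≤2`, and so of the 3 in `K`.
      ½≤L : ½ ≤ L
      ½≤L = *-cancelˡ-≤ 0<N (begin
        N * ½               ≈⟨ solve 2 (λ N h → N :* h := (:1 :+ :1) :* h :+ (N :- (:1 :+ :1)) :* h) refl N ½ ⟩
        (1# + 1#) * ½ + (N - (1# + 1#)) * ½
                            ≤⟨ +-monoʳ-≤ _ (*-monoˡ-≤ (x≤y⇒0≤y-x 2≤N) ½≤1) ⟩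
        (1# + 1#) * ½ + (N - (1# + 1#)) * 1#
                            ≈⟨ +-congʳ (*-inverseʳ _ (<⇒≉0 0<2)) ⟩
        1# + (N - (1# + 1#)) * 1#
                            ≈⟨ solve 1 (λ N → :1 :+ (N :- (:1 :+ :1)) :* :1 := N :- :1) refl N ⟩
        N - 1#              ≤⟨ x-1≤x*ln 0<N ⟩
        N * L               ∎)

      0<L : 0# < L
      0<L = <-≤-trans 0<½ ½≤L

      qL≤1 : q * L ≤ 1#
      qL≤1 = begin
        q * L       ≤⟨ *-monoʳ-≤ (proj₁ 0<L) (0≤y-x⇒x≤y (≤-respʳ
                         (solve 2 (λ p l → :1 :+ l :- p := l :- (p :- :1)) refl p (L ⁻¹)) (x≤y⇒0≤y-x p≤))) ⟩
        L ⁻¹ * L    ≈⟨ *-inverseˡ L (<⇒≉0 0<L) ⟩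
        1#          ∎

    p-1≤2 : p - 1# ≤ 1# + 1#
    p-1≤2 = *-cancelˡ-≤ 0<½ (begin
      ½ * q          ≤⟨ *-monoʳ-≤ 0≤p-1 ½≤L ⟩
      L * q          ≈⟨ *-comm L q ⟩
      q * L          ≤⟨ qL≤1 ⟩
      1#             ≈⟨ *-inverseˡ _ (<⇒≉0 0<2) ⟨
      ½ * (1# + 1#)  ∎)

    n^[p-1]≤e : fromℕ n ^ʳ (p - 1#) ≤ e
    n^[p-1]≤e = ≤-respˡ (sym (^ʳ-pos q 0<N)) (exp-mono qL≤1)

  module _ {l m k d ε} {G : BipartiteGraph (suc l) m}
           (1≤d : 1 ℕ.≤ d) (0<ε : 0# < ε)
           (expander : IsUnbalancedExpander k ε d G)
           {x : Vector Carrier (suc l)} (sparse : IsSparse k x) where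

    private
      n : ℕ
      n = suc l

      D : Carrier
      D = fromℕ d

      0<D : 0# < D
      0<D = <-≤-trans (fromℕ-pos 0) (fromℕ-mono 1≤d)

      z : Fin m → Fin n → Carrier
      z j i = adjacency G j i * x i

      maxIndex : ∀ j → ∃ λ i → ∀ i′ → ∣ z j i′ ∣ʳ ≤ ∣ z j i ∣ʳ
      maxIndex j = argmax λ i → ∣ z j i ∣ʳ

      a s : Fin m → Carrier
      a j = ∣ z j (proj₁ (maxIndex j)) ∣ʳ
      s j = ∣ (adjacency G *ᵥ x) j ∣ʳ

      ∣z∣≈ : ∀ j i → ∣ z j i ∣ʳ ≈ adjacency G j i * ∣ x i ∣ʳ
      ∣z∣≈ j i = ∣∣-*ˡ (x i) (indicator-nonNeg (G i) j)

      ∣x∣≤a : ∀ {i j} → j ∈ G i → ∣ x i ∣ʳ ≤ a j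
      ∣x∣≤a {i} {j} j∈Gi = ≤-respˡ
        (trans (∣z∣≈ j i) (trans (*-congʳ (indicator-∈ j∈Gi)) (*-identityˡ _)))
        (proj₂ (maxIndex j) i)

      [1-ε]dW≤ : ∀ (w : Fin n → Carrier) (A : Fin m → Carrier) →
        (∀ i → 0# ≤ w i) → (∀ {i} → x i ≈ 0# → w i ≈ 0#) →
        (∀ j → 0# ≤ A j) → (∀ {i j} → j ∈ G i → w i ≤ A j) →
        (1# - ε) * D * sum w ≤ sum A
      [1-ε]dW≤ = expansion expander sparse

    ℓ₁-upper : ‖ adjacency G *ᵥ x ‖[ 1# ] * D ⁻¹ ≤ ‖ x ‖[ 1# ]
    ℓ₁-upper = begin
      ‖ adjacency G *ᵥ x ‖[ 1# ] * D ⁻¹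
        ≈⟨ *-congʳ (‖‖-1 (adjacency G *ᵥ x)) ⟩
      sum s * D ⁻¹
        ≤⟨ *-monoʳ-≤ (proj₁ (⁻¹-pos 0<D)) (sum-mono λ j → ∣sum∣≤sum∣∣ (z j)) ⟩
      sum (λ j → sum λ i → ∣ z j i ∣ʳ) * D ⁻¹
        ≈⟨ *-congʳ (trans (sum-cong-≋ λ j → sum-cong-≋ (∣z∣≈ j)) (sum-adjacency expander (∣_∣ʳ ∘ x))) ⟩
      D * W * D ⁻¹
        ≈⟨ solve 3 (λ d w i → d :* w :* i := d :* i :* w) refl D W (D ⁻¹) ⟩
      D * D ⁻¹ * W
        ≈⟨ trans (*-congʳ (*-inverseʳ D (<⇒≉0 0<D))) (*-identityˡ W) ⟩
      W
        ≈⟨ ‖‖-1 x ⟨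
      ‖ x ‖[ 1# ] ∎
      where W = sum (∣_∣ʳ ∘ x)

    -- Every row has |Σ z| ≥ 2 a - Σ |z|. Summed over the rows, expansion gives at least 2 (1 - ε) d
    -- ‖x‖₁ - d ‖x‖₁, whence the constant 2.
    ℓ₁-lower : (1# - fromℕ 2 * ε) * ‖ x ‖[ 1# ] ≤ ‖ adjacency G *ᵥ x ‖[ 1# ] * D ⁻¹
    ℓ₁-lower = *-cancelˡ-≤ 0<D (begin
      D * ((1# - fromℕ 2 * ε) * ‖ x ‖[ 1# ])
        ≈⟨ *-congˡ (*-cong (+-congˡ (-‿cong (*-congʳ fromℕ-2))) (‖‖-1 x)) ⟩
      D * ((1# - (1# + 1#) * ε) * W)
        ≈⟨ solve 3 (λ d ε w → d :* ((:1 :- (:1 :+ :1) :* ε) :* w) :=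
             (:1 :- ε) :* d :* w :+ (:1 :- ε) :* d :* w :+ :- (d :* w)) refl D ε W ⟩
      (1# - ε) * D * W + (1# - ε) * D * W + - (D * W)
        ≤⟨ +-mono-≤ (+-mono-≤ expansion-a expansion-a) ≤-refl ⟩
      sum a + sum a + - (D * W)
        ≈⟨ +-cong (sym (∑-distrib-+ a a)) (-‿cong (sym sum-z≈DW)) ⟩
      sum (λ j → a j + a j) + - sum (λ j → sum λ i → ∣ z j i ∣ʳ)
        ≤⟨ +-mono-≤ (sum-mono λ j → twice-∣term∣ (z j) (proj₁ (maxIndex j))) ≤-refl ⟩
      sum (λ j → s j + sum λ i → ∣ z j i ∣ʳ) + - sum (λ j → sum λ i → ∣ z j i ∣ʳ)
        ≈⟨ +-congʳ (∑-distrib-+ s (λ j → sum λ i → ∣ z j i ∣ʳ)) ⟩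
      sum s + Z + - Z
        ≈⟨ solve 2 (λ s t → s :+ t :+ :- t := s) refl (sum s) Z ⟩
      sum s
        ≈⟨ trans (*-congʳ (*-inverseʳ D (<⇒≉0 0<D))) (*-identityˡ _) ⟨
      D * D ⁻¹ * sum s
        ≈⟨ solve 3 (λ d i s → d :* i :* s := d :* (s :* i)) refl D (D ⁻¹) (sum s) ⟩
      D * (sum s * D ⁻¹)
        ≈⟨ *-congˡ (*-congʳ (‖‖-1 (adjacency G *ᵥ x))) ⟨
      D * (‖ adjacency G *ᵥ x ‖[ 1# ] * D ⁻¹) ∎)
      where
      W Z : Carrier
      W = sum (∣_∣ʳ ∘ x)
      Z = sum λ j → sum λ i → ∣ z j i ∣ʳ
      sum-z≈DW : Z ≈ D * W
      sum-z≈DW = trans (sum-cong-≋ λ j → sum-cong-≋ (∣z∣≈ j)) (sum-adjacency expander (∣_∣ʳ ∘ x))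
      expansion-a : (1# - ε) * D * W ≤ sum a
      expansion-a = [1-ε]dW≤ (∣_∣ʳ ∘ x) a (∣∣-nonNeg ∘ x) ∣0∣≈0 (λ j → ∣∣-nonNeg _) ∣x∣≤a

    module _ {p} (1≤p : 1# ≤ p) (2≤n : 2 ℕ.≤ suc l) (p≤ : p ≤ 1# + ln (fromℕ (suc l)) ⁻¹)
             (N⁻¹≤ε : fromℕ (suc l) ⁻¹ ≤ ε) where

      private
        0≤p : 0# ≤ p
        0≤p = ≤-trans 0≤1 1≤p

        0<p : 0# < p
        0<p = <-≤-trans 0<1 1≤p

        p≈1+[p-1] : p ≈ 1# + (p - 1#)
        p≈1+[p-1] = solve 1 (λ p → p := :1 :+ (p :- :1)) refl p

        module R (j : Fin m) = Row {l} {p} {p - 1#} {ε}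
          p≈1+[p-1] (0≤p-1 2≤n 1≤p p≤) (p-1≤2 2≤n 1≤p p≤) (n^[p-1]≤e 2≤n 1≤p p≤) N⁻¹≤ε
          (z j) (proj₁ (maxIndex j)) (proj₂ (maxIndex j))

        u : Fin n → Carrier
        u i = ∣ x i ∣ʳ ^ʳ p

        W α β S : Carrier
        W = sum u
        α = sum R.A
        β = D * W
        S = sum λ j → s j ^ʳ p

        -- The matrix entries 0 and 1 are their own p-th powers.
        ∣z∣^p≈ : ∀ j i → ∣ z j i ∣ʳ ^ʳ p ≈ adjacency G j i * u i
        ∣z∣^p≈ j i with j ∈? G i
        ... | yes _ = trans (^ʳ-cong (∣∣-nonNeg _) (∣∣-cong (*-identityˡ (x i))) refl) (sym (*-identityˡ _))
        ... | no  _ = trans (^ʳ-zero p (∣0∣≈0 (zeroˡ (x i)))) (sym (zeroˡ _))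

        sum-V≈β : sum R.V ≈ β
        sum-V≈β = trans (sum-cong-≋ λ j → sum-cong-≋ (∣z∣^p≈ j)) (sum-adjacency expander u)

        α≤β : α ≤ β
        α≤β = ≤-respʳ sum-V≈β (sum-mono R.A≤V)

        [1-ε]β≤α : (1# - ε) * D * W ≤ α
        [1-ε]β≤α = [1-ε]dW≤ u R.A (λ i → ^ʳ-nonNeg (∣ x i ∣ʳ) p) (λ xi≈0 → ^ʳ-zero p (∣0∣≈0 xi≈0))
          (λ j → ^ʳ-nonNeg (a j) p) (λ {i} j∈Gi → ^ʳ-mono 0≤p (∣∣-nonNeg (x i)) (∣x∣≤a j∈Gi))

        sum-error : ∀ (f : Fin m → Carrier) →
          sum (λ j → f j + K * (ε * R.A j + (R.V j - R.A j))) ≈ sum f + K * (ε * α + (β - α))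
        sum-error f = begin-equality
          sum (λ j → f j + K * (ε * R.A j + (R.V j - R.A j)))
            ≈⟨ sum-+* f (λ j → ε * R.A j + (R.V j - R.A j)) K ⟩
          sum f + K * sum (λ j → ε * R.A j + (R.V j - R.A j))
            ≈⟨ +-congˡ (*-congˡ (begin-equality
                 sum (λ j → ε * R.A j + (R.V j - R.A j))
                   ≈⟨ sum-cong-≋ (λ j → solve 3 (λ ε A V → ε :* A :+ (V :- A) := V :+ (ε :- :1) :* A) refl ε (R.A j) (R.V j)) ⟩
                 sum (λ j → R.V j + (ε - 1#) * R.A j)
                   ≈⟨ sum-+* R.V R.A (ε - 1#) ⟩
                 sum R.V + (ε - 1#) * α
                   ≈⟨ +-congʳ sum-V≈β ⟩
                 β + (ε - 1#) * α
                   ≈⟨ solve 3 (λ ε A V → V :+ (ε :- :1) :* A := ε :* A :+ (V :- A)) refl ε α β ⟩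
                 ε * α + (β - α) ∎)) ⟩
          sum f + K * (ε * α + (β - α)) ∎

        -- As (1 - ε) β ≤ α ≤ β, both ε α and β - α are at most ε β.
        error≤ : K * (ε * α + (β - α)) ≤ (K + K) * (ε * β)
        error≤ = ≤-by (*-nonNeg 0≤K (+-nonNeg (*-nonNeg (proj₁ 0<ε) (x≤y⇒0≤y-x α≤β)) (x≤y⇒0≤y-x [1-ε]β≤α)))
          (solve 5 (λ K ε α d w → (K :+ K) :* (ε :* (d :* w)) :=
              K :* (ε :* α :+ (d :* w :- α)) :+ K :* (ε :* (d :* w :- α) :+ (α :- (:1 :- ε) :* d :* w)))
            refl K ε α D W)

        0≤W : 0# ≤ W
        0≤W = sum-nonNeg λ i → ^ʳ-nonNeg (∣ x i ∣ʳ) p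

        0≤εβ : 0# ≤ ε * β
        0≤εβ = *-nonNeg (proj₁ 0<ε) (*-nonNeg (proj₁ 0<D) 0≤W)

        S≤ : S ≤ D * ((1# + C * ε) * W)
        S≤ = begin
          S
            ≤⟨ ≤-respʳ (sum-error R.A) (sum-mono R.row-upper) ⟩
          α + K * (ε * α + (β - α))
            ≤⟨ +-mono-≤ α≤β error≤ ⟩
          β + (K + K) * (ε * β)
            ≤⟨ ≤-by 0≤εβ (solve 4 (λ d w K ε → d :* ((:1 :+ (:1 :+ K) :* ε) :* w) :=
                 d :* w :+ K :* (ε :* (d :* w)) :+ ε :* (d :* w)) refl D W (K + K) ε) ⟩
          D * ((1# + C * ε) * W) ∎

        ≤S : D * ((1# - C * ε) * W) ≤ S
        ≤S = begin
          D * ((1# - C * ε) * W)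
            ≈⟨ solve 4 (λ d w K ε → d :* ((:1 :- (:1 :+ K) :* ε) :* w) :=
                 (:1 :- ε) :* d :* w :+ :- (K :* (ε :* (d :* w)))) refl D W (K + K) ε ⟩
          (1# - ε) * D * W + - ((K + K) * (ε * β))
            ≤⟨ +-mono-≤ [1-ε]β≤α (-‿mono-≤ error≤) ⟩
          α + - (K * (ε * α + (β - α)))
            ≤⟨ +-mono-≤ (≤-respʳ (sum-error (λ j → s j ^ʳ p)) (sum-mono R.row-lower)) ≤-refl ⟩
          S + K * (ε * α + (β - α)) + - (K * (ε * α + (β - α)))
            ≈⟨ solve 2 (λ s t → s :+ t :+ :- t := s) refl S _ ⟩
          S ∎

        c c^p r Y : Carrier
        c   = D ^ʳ (- (p ⁻¹))
        c^p = c ^ʳ p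
        r   = p ⁻¹
        Y   = sum λ j → ∣ (c ∙ (adjacency G *ᵥ x)) j ∣ʳ ^ʳ p

        c^p*D≈1 : c^p * D ≈ 1#
        c^p*D≈1 = begin-equality
          c ^ʳ p * D            ≈⟨ *-comm _ _ ⟩
          D * c ^ʳ p            ≈⟨ *-congˡ (^ʳ-assoc (- r) p (proj₁ 0<D)) ⟩
          D * D ^ʳ (- r * p)    ≈⟨ *-congˡ (^ʳ-cong (proj₁ 0<D) refl (trans
                                     (solve 2 (λ r p → (:- r) :* p := :- (p :* r)) refl r p)
                                     (-‿cong (*-inverseʳ p (<⇒≉0 0<p))))) ⟩
          D * D ^ʳ (- 1#)       ≈⟨ ^ʳ-1+ (- 1#) (proj₁ 0<D) ⟨
          D ^ʳ (1# - 1#)        ≈⟨ ^ʳ-pos _ 0<D ⟩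
          exp ((1# - 1#) * ln D) ≈⟨ exp-cong (solve 1 (λ l → (:1 :- :1) :* l := :0) refl (ln D)) ⟩
          exp 0#                ≈⟨ exp-0 ⟩
          1#                    ∎

        0≤c^p : 0# ≤ c^p
        0≤c^p = ^ʳ-nonNeg c p

        Y≈c^p*S : Y ≈ c^p * S
        Y≈c^p*S = begin-equality
          Y
            ≈⟨ sum-cong-≋ (λ j → begin-equality
                 ∣ c * y j ∣ʳ ^ʳ p   ≈⟨ ^ʳ-cong (∣∣-nonNeg (c * y j)) (∣∣-*ˡ (y j) 0≤c) refl ⟩
                 (c * s j) ^ʳ p      ≈⟨ ^ʳ-distrib-* p 0≤c (∣∣-nonNeg (y j)) ⟩
                 c^p * s j ^ʳ p      ∎) ⟩
          sum (λ j → c^p * s j ^ʳ p)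
            ≈⟨ *-distribˡ-sum c^p (λ j → s j ^ʳ p) ⟨
          c^p * S ∎
          where
          y : Fin m → Carrier
          y = adjacency G *ᵥ x
          0≤c : 0# ≤ c
          0≤c = ^ʳ-nonNeg D (- (p ⁻¹))

        c^p*D* : ∀ t → c^p * (D * t) ≈ t
        c^p*D* t = trans (sym (*-assoc _ _ _)) (trans (*-congʳ c^p*D≈1) (*-identityˡ t))

        Y≤ : Y ≤ (1# + C * ε) * W
        Y≤ = ≤-respˡ (sym Y≈c^p*S) (≤-respʳ (c^p*D* _) (*-monoˡ-≤ 0≤c^p S≤))

        ≤Y : (1# - C * ε) * W ≤ Y
        ≤Y = ≤-respʳ (sym Y≈c^p*S) (≤-respˡ (c^p*D* _) (*-monoˡ-≤ 0≤c^p ≤S))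

        0≤Y : 0# ≤ Y
        0≤Y = sum-nonNeg λ j → ^ʳ-nonNeg (∣ (c ∙ (adjacency G *ᵥ x)) j ∣ʳ) p

        0≤r : 0# ≤ r
        0≤r = proj₁ (⁻¹-pos 0<p)

        r≤1 : r ≤ 1#
        r≤1 = begin
          r        ≈⟨ *-identityˡ r ⟨
          1# * r   ≤⟨ *-monoʳ-≤ 0≤r 1≤p ⟩
          p * r    ≈⟨ *-inverseʳ p (<⇒≉0 0<p) ⟩
          1#       ∎

        0≤Cε : 0# ≤ C * ε
        0≤Cε = *-nonNeg (≤-trans 0≤1 (proj₁ 1<C)) (proj₁ 0<ε)

      ℓₚ-upper : ‖ (D ^ʳ (- (p ⁻¹))) ∙ (adjacency G *ᵥ x) ‖[ p ] ≤ (1# + C * ε) * ‖ x ‖[ p ]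
      ℓₚ-upper = begin
        Y ^ʳ r                           ≤⟨ ^ʳ-mono 0≤r 0≤Y Y≤ ⟩
        ((1# + C * ε) * W) ^ʳ r          ≈⟨ ^ʳ-distrib-* r (+-nonNeg 0≤1 0≤Cε) 0≤W ⟩
        (1# + C * ε) ^ʳ r * W ^ʳ r       ≤⟨ *-monoʳ-≤ (^ʳ-nonNeg W r) (^ʳ≤x (x≤x+y 0≤Cε) r≤1) ⟩
        (1# + C * ε) * W ^ʳ r            ∎

      ℓₚ-lower : (1# - C * ε) * ‖ x ‖[ p ] ≤ ‖ (D ^ʳ (- (p ⁻¹))) ∙ (adjacency G *ᵥ x) ‖[ p ]
      -- Taking the root of the factor requires a nonnegative base. In the other case the left side
      -- is at most zero, and a norm is nonnegative.
      ℓₚ-lower with total 0# (1# - C * ε)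
      ... | inj₁ 0≤1-Cε = begin
        (1# - C * ε) * W ^ʳ r            ≤⟨ *-monoʳ-≤ (^ʳ-nonNeg W r) (x≤^ʳ 0≤1-Cε 1-Cε≤1 r≤1) ⟩
        (1# - C * ε) ^ʳ r * W ^ʳ r       ≈⟨ ^ʳ-distrib-* r 0≤1-Cε 0≤W ⟨
        ((1# - C * ε) * W) ^ʳ r          ≤⟨ ^ʳ-mono 0≤r (*-nonNeg 0≤1-Cε 0≤W) ≤Y ⟩
        Y ^ʳ r                           ∎
        where
        1-Cε≤1 : 1# - C * ε ≤ 1#
        1-Cε≤1 = ≤-by 0≤Cε (solve 1 (λ t → :1 := :1 :- t :+ t) refl (C * ε))
      ... | inj₂ 1-Cε≤0 = ≤-trans (0≤-x⇒x≤0 (≤-respʳ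
        (solve 2 (λ t w → (:- t) :* w := :- (t :* w)) refl (1# - C * ε) (W ^ʳ r))
        (*-nonNeg (x≤0⇒0≤-x 1-Cε≤0) (^ʳ-nonNeg W r)))) (^ʳ-nonNeg Y r)

  N⁻¹≤ε : ∀ {n ε} → 0# < ε → ε ⁻¹ < fromℕ n → fromℕ n ⁻¹ ≤ ε
  N⁻¹≤ε {n} {ε} 0<ε ε⁻¹<N = *-cancelˡ-≤ 0<N (begin
    N * N ⁻¹   ≈⟨ *-inverseʳ N (<⇒≉0 0<N) ⟩
    1#         ≈⟨ *-inverseˡ ε (<⇒≉0 0<ε) ⟨
    ε ⁻¹ * ε   ≤⟨ *-monoʳ-≤ (proj₁ 0<ε) (proj₁ ε⁻¹<N) ⟩
    N * ε      ∎)
    where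
    N = fromℕ n
    0<N : 0# < N
    0<N = ≤-<-trans (proj₁ (⁻¹-pos 0<ε)) ε⁻¹<N

theorem1 : ∀ {ℓ} (em : ExcludedMiddle ℓ) (ℝ : CompleteOrderedField ℓ) →
    let open CompleteOrderedField ℝ
        open RealAnalysis em ℝ
    in
    ∃ λ (C : Carrier) → (1# < C) ×
      (∀ (n m k d : ℕ) (ε : Carrier) (G : BipartiteGraph n m) →
       2 ℕ.≤ n → 1 ℕ.≤ d → d ℕ.< n →
       0# < ε → ε ⁻¹ < fromℕ n →
       IsUnbalancedExpander k ε d G →
       ∀ (x : Vector Carrier n) → IsSparse k x →
         (∀ (p : Carrier) → 1# ≤ p → p ≤ 1# + ln (fromℕ n) ⁻¹ →
            ((1# - C * ε) * ‖ x ‖[ p ]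
               ≤ ‖ (fromℕ d ^ʳ (- (p ⁻¹))) ∙ (adjacency G *ᵥ x) ‖[ p ]) ×
            (‖ (fromℕ d ^ʳ (- (p ⁻¹))) ∙ (adjacency G *ᵥ x) ‖[ p ]
               ≤ (1# + C * ε) * ‖ x ‖[ p ])) ×
         (((1# - fromℕ 2 * ε) * ‖ x ‖[ 1# ]
             ≤ ‖ adjacency G *ᵥ x ‖[ 1# ] * fromℕ d ⁻¹) ×
          (‖ adjacency G *ᵥ x ‖[ 1# ] * fromℕ d ⁻¹ ≤ ‖ x ‖[ 1# ])))
-- The bound 2 ≤ n excludes n = 0; the form `suc l` gives `argmax` a nonempty index set.
theorem1 em ℝ = C , 1<C , λ { (suc l) m k d ε G 2≤n 1≤d _ 0<ε ε⁻¹<n expander x sparse →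
    (λ p 1≤p p≤ →
      ℓₚ-lower 1≤d 0<ε expander {x} sparse 1≤p 2≤n p≤ (N⁻¹≤ε {suc l} 0<ε ε⁻¹<n) ,
      ℓₚ-upper 1≤d 0<ε expander {x} sparse 1≤p 2≤n p≤ (N⁻¹≤ε {suc l} 0<ε ε⁻¹<n)) ,
    ℓ₁-lower 1≤d 0<ε expander {x} sparse ,
    ℓ₁-upper 1≤d 0<ε expander {x} sparse }
  where open Isometry em ℝ
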